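{- Let $M$ be a sharp, integral monoid, let $\Gamma$ be an $M$-metrised graph, and let $G$ be its underlying graph. Then there is a subdivision $H$ of $G$ such that $\operatorname{dgon}(\Gamma)\ge\operatorname{dgon}(H)$.
   Context: Monoids are commutative with identity $0$; sharp means $0$ is the only invertible element, integral means cancellative; $M^{gp}$ is the groupification. A graph is $(X,r,i)$ with $X$ finite, $r$ idempotent, $i$ an involution, $i(x)=x\iff r(x)=x$; vertices $V$ = fixed points of $i$, half-edges $H=X\setminus V$, edges $\{e,i(e)\}$, $H_v=\{e: r(e)=v\}$; graphs are connected (loops and multiple edges allowed). An $M$-metrised graph is a graph with $l:X\to M$, $l(i(x))=l(x)$, $l(x)=0\iff x\in V$; its underlying graph is $(X,r,i)$. Divisors are elements of the free abelian group on $V$; $\operatorname{PL}(\Gamma)=\{g:V\to M^{gp}: g(r(e))-g(r(i(e)))\in\langle l(e)\rangle\ \forall e\in H\}$; Laplacian $\Delta(g)=\sum_v\sum_{e\in H_v}\frac{g(v)-g(r(i(e)))}{l(e)}[v]$ (the quotients being well-defined integers); $D\sim D'$ iff $D-D'\in\Delta(\operatorname{PL}(\Gamma))$; $|D|=\{E\ge0:E\sim D\}$; $r(D)=\max\{k: |D-F|\ne\emptyset$ for all effective $F$ of degree $k\}$; $\operatorname{dgon}(\Gamma)=\min\{\deg D: r(D)\ge1\}$. For an unmetrised graph $H$, $\operatorname{dgon}(H)$ is the divisorial gonality of $H$ regarded as an $\mathbb N$-metrised graph with all edge lengths $1$ (the usual Baker–Norine divisorial gonality). A subdivision operation replaces an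 edge $\{e,i(e)\}$ by a new vertex $w$ and two edges joining $r(e)$ to $w$ and $w$ to $r(i(e))$; a subdivision of $G$ is a graph obtained by finitely many subdivision operations. -}

module Defs where

open import Level using (Level; _⊔_)
open import Algebra.Bundles using (CommutativeMonoid)
open import Data.Nat as ℕ using (ℕ; zero; suc)
open import Data.Nat.Properties using (+-0-commutativeMonoid)
open import Data.Integer as ℤ using (ℤ; +_; -[1+_]; _-_) renaming (_+_ to _+ℤ_)
open import Data.Fin using (Fin; zero; suc)
open import Data.Fin.Properties using (_≟_)
open import Data.Product using (Σ; ∃; ∃-syntax; _×_; _,_)
open import Data.Bool using (if_then_else_; _∧_; not)
open import Relation.Nullary using (¬_; does)
open import Relation.Binary.PropositionalEquality using (_≡_; _≢_)

module _ {c ℓ} (M : CommutativeMonoid c ℓ) where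
  open CommutativeMonoid M

  IsSharp : Set (c ⊔ ℓ)
  IsSharp = ∀ a → (∃[ b ] (a ∙ b ≈ ε)) → a ≈ ε

  IsIntegral : Set (c ⊔ ℓ)
  IsIntegral = ∀ a b x → a ∙ x ≈ b ∙ x → a ≈ b

-- u can reach v: walk along edges {e , i e} from r e to r (i e)
data Reach {n : ℕ} (r i : Fin n → Fin n) (u : Fin n) : Fin n → Set where
  here : Reach r i u u
  step : ∀ {e} → Reach r i u (r e) → Reach r i u (r (i e))

record Graph (n : ℕ) : Set where
  field
    r i       : Fin n → Fin n
    r-idem    : ∀ x → r (r x) ≡ r x
    i-invol   : ∀ x → i (i x) ≡ x
    fix-i⇒r   : ∀ x → i x ≡ x → r x ≡ x
    fix-r⇒i   : ∀ x → r x ≡ x → i x ≡ x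
    hasVertex : ∃[ v ] (i v ≡ v)
    connected : ∀ u v → i u ≡ u → i v ≡ v → Reach r i u v

sumℤ : ∀ {n} → (Fin n → ℤ) → ℤ
sumℤ {zero}  f = + 0
sumℤ {suc n} f = f zero +ℤ sumℤ (λ x → f (suc x))

module _ {c ℓ} (M : CommutativeMonoid c ℓ) {n : ℕ} (G : Graph n) where
  open CommutativeMonoid M
  open Graph G

  record IsMetrisation (l : Fin n → Carrier) : Set (c ⊔ ℓ) where
    field
      l-sym       : ∀ x → l (i x) ≈ l x
      zero⇒vertex : ∀ x → l x ≈ ε → i x ≡ x
      vertex⇒zero : ∀ x → i x ≡ x → l x ≈ ε

  -- groupification M^gp: formal differences (a , b) = a - b
  Gp : Set c
  Gp = Carrier × Carrier

  _≈gp_ : Gp → Gp → Set ℓ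
  (a , b) ≈gp (a' , b') = a ∙ b' ≈ a' ∙ b

  _-gp_ : Gp → Gp → Gp
  (a , b) -gp (a' , b') = (a ∙ b' , b ∙ a')

  times : ℕ → Carrier → Carrier
  times zero    x = ε
  times (suc k) x = x ∙ times k x

  _·gp_ : ℤ → Carrier → Gp
  (+ k)    ·gp x = (times k x , ε)
  -[1+ k ] ·gp x = (ε , times (suc k) x)

  -- g ∈ PL(Γ), with q e the (unique) integer (g(r e) - g(r(i e))) / l(e)
  PLWitness : (l : Fin n → Carrier) → (Fin n → Gp) → (Fin n → ℤ) → Set ℓ
  PLWitness l g q = ∀ e → i e ≢ e → (g (r e) -gp g (r (i e))) ≈gp (q e ·gp l e)

  lap : (Fin n → ℤ) → Fin n → ℤ
  lap q v = sumℤ (λ e → if does (r e ≟ v) ∧ not (does (i e ≟ e)) then q e else + 0)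

  IsDivisor : (Fin n → ℤ) → Set
  IsDivisor D = ∀ x → i x ≢ x → D x ≡ + 0

  Effective : (Fin n → ℤ) → Set
  Effective D = ∀ x → + 0 ℤ.≤ D x

  deg : (Fin n → ℤ) → ℤ
  deg = sumℤ

  LinEquiv : (Fin n → Carrier) → (Fin n → ℤ) → (Fin n → ℤ) → Set (c ⊔ ℓ)
  LinEquiv l D D' = ∃[ g ] ∃[ q ] (PLWitness l g q × (∀ x → D x - D' x ≡ lap q x))

  LinSysNonempty : (Fin n → Carrier) → (Fin n → ℤ) → Set (c ⊔ ℓ)
  LinSysNonempty l D = ∃[ E ] (IsDivisor E × Effective E × LinEquiv l E D)

  -- k belongs to the set whose maximum is r(D)
  RankCond : (Fin n → Carrier) → (Fin n → ℤ) → ℕ → Set (c ⊔ ℓ)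
  RankCond l D k = ∀ F → IsDivisor F → Effective F → deg F ≡ + k →
                   LinSysNonempty l (λ x → D x - F x)

  RankAtLeast : (Fin n → Carrier) → (Fin n → ℤ) → ℕ → Set (c ⊔ ℓ)
  RankAtLeast l D k = ∃[ j ] (k ℕ.≤ j × RankCond l D j)

  IsDgon : (Fin n → Carrier) → ℤ → Set (c ⊔ ℓ)
  IsDgon l d = (∃[ D ] (IsDivisor D × RankAtLeast l D 1 × deg D ≡ d))
             × (∀ D → IsDivisor D → RankAtLeast l D 1 → d ℤ.≤ deg D)

ℕ+ : CommutativeMonoid _ _
ℕ+ = +-0-commutativeMonoid

unitLen : ∀ {n} → Graph n → Fin n → ℕ
unitLen G x = if does (Graph.i G x ≟ x) then 0 else 1

IsDgonUnmetrised : ∀ {n} → Graph n → ℤ → Set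
IsDgonUnmetrised G d = IsDgon ℕ+ G (unitLen G) d

-- Subdivision of the edge {e , i e} of G.
-- New set X' = Fin (suc (suc (suc n))): 0 = new vertex w, 1 = a, 2 = b, suc³ x = old x.
-- Edges {e , a} (joining r e to w) and {b , i e} (joining w to r (i e)).

module _ {n} (G : Graph n) (e : Fin n) where
  open Graph G

  old : Fin n → Fin (suc (suc (suc n)))
  old x = suc (suc (suc x))

  subR : Fin (suc (suc (suc n))) → Fin (suc (suc (suc n)))
  subR zero                   = zero
  subR (suc zero)             = zero
  subR (suc (suc zero))       = zero
  subR (suc (suc (suc x)))    = old (r x)

  subI : Fin (suc (suc (suc n))) → Fin (suc (suc (suc n)))
  subI zero                   = zero
  subI (suc zero)             = old e
  subI (suc (suc zero))       = old (i e)
  subI (suc (suc (suc x)))    =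
    if does (x ≟ e) then suc zero
    else if does (x ≟ i e) then suc (suc zero)
    else old (i x)

SubdivStep : ∀ {n} → Graph n → Graph (suc (suc (suc n))) → Set
SubdivStep G H = ∃[ e ] (Graph.i G e ≢ e
                   × (∀ x → Graph.r H x ≡ subR G e x)
                   × (∀ x → Graph.i H x ≡ subI G e x))

data Subdivision {n} (G : Graph n) : ∀ {m} → Graph m → Set where
  base : Subdivision G G
  step : ∀ {m} {H : Graph m} {K : Graph (suc (suc (suc m)))} →
         Subdivision G H → SubdivStep H K → Subdivision G K

{-# OPTIONS --safe #-}

-- Fix a divisor of positive rank on Γ together with, for each vertex v, a piecewise linear function moving a chip to v.
-- The integer slopes of these functions turn "there are edge lengths realising these slopes" into a homogeneous linear system.
-- A solution in a sharp integral monoid survives Fourier–Motzkin elimination, because the monoid order is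
-- additive, cancellative and irreflexive, and can then be lifted back to a solution in the positive integers.
-- Slopes are bounded by the degree (flow out of a level set), so the least degree d for which integer lengths
-- exist is found by a finite search that depends on G alone.  Subdividing the edges according to these lengths
-- gives H: an edge needs subdividing only if some function has nonzero slope along it, and truncating that
-- function at the value of a subdivision point w moves a chip to w.  Hence dgon H ≤ d ≤ dgon Γ.
module Submission where

open import Defs
open import Level using (_⊔_) renaming (suc to lsuc)
open import Algebra.Bundles using (CommutativeMonoid)
open import Algebra.Properties.CommutativeSemigroup using (interchange; x∙yz≈y∙xz)
open import Data.Bool using (Bool; true; false; _∨_; if_then_else_; _∧_; not)
open import Data.Bool.Properties using (∨-idem)
open import Data.Nat as ℕ using (ℕ; zero; suc; _∸_)
open import Data.Nat.Induction using (<-wellFounded)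
import Data.Nat.Properties as ℕₚ
import Data.Nat.Tactic.RingSolver as ℕ-Ring
open import Data.Integer as ℤ using (ℤ; +_; -[1+_]; _+_; _*_; _-_; -_; _≤_; _<_; +≤+; +<+; ∣_∣)
import Data.Integer.Properties as ℤₚ
import Data.Integer.Tactic.RingSolver as ℤ-Ring
open import Algebra.Properties.CommutativeMonoid.Sum ℤₚ.+-0-commutativeMonoid using (sum; ∑-comm; sum-permute)
open import Data.Fin using (Fin; zero; suc; combine; remQuot; fromℕ<; toℕ)
open import Data.Fin.Permutation using (permutation)
open import Data.Fin.Properties using (_≟_; any?; all?; remQuot-combine; toℕ-fromℕ<; ¬∀⟶∃¬)
open import Data.List using (List; []; _∷_; map; _++_; cartesianProductWith; concat; allFin)
open import Data.List.Membership.Propositional using (_∈_)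
open import Data.List.Membership.Propositional.Properties using (∈-map⁺; ∈-map⁻; ∈-++⁺ˡ; ∈-++⁺ʳ; ∈-++⁻; ∈-cartesianProductWith⁺; ∈-cartesianProductWith⁻; ∈-concat⁺′; ∈-concat⁻′; ∈-allFin)
open import Data.List.Relation.Unary.Any using (here; there)
open import Data.Product using (Σ; ∃; ∃-syntax; _×_; _,_; proj₁; proj₂)
open import Data.Sum using (_⊎_; inj₁; inj₂)
open import Data.Vec using (Vec; []; _∷_; lookup; tabulate)
open import Data.Vec.Properties using (lookup∘tabulate)
open import Function using (_∘_)
open import Induction.WellFounded using (Acc; acc)
open import Relation.Binary.Definitions using (Tri; tri<; tri≈; tri>)
open import Relation.Binary.PropositionalEquality using (_≡_; _≢_; refl; sym; trans; cong; cong₂; subst; subst₂; module ≡-Reasoning)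
open import Relation.Nullary using (¬_; Dec; yes; no; does; contradiction)
open import Relation.Nullary.Decidable using (map′; _×-dec_; _→-dec_; ¬?)

-- Fourier–Motzkin elimination

-- `H` has to be produced before any value of dgon(Γ) or any optimal divisor on Γ is at hand, and no
-- decision procedure for relations in `M` is assumed. Hence the search runs over data of `G` alone,
-- and divisors on Γ enter only afterwards, to be compared with its result. The obstacle inside `M`
-- is that elements can be neither subtracted nor divided and that the order is partial, so no
-- extremal bound for an unknown can be selected there. Elimination has an asymmetry that fits this:
-- running it forwards takes only sums, multiples and cancellation, which `M` offers, whereas
-- back-substitution, which compares bounds and takes a midpoint, is carried out over the integers.
-- The two runs meet in the system without unknowns, where nothing but the strictness flags is left.
-- Over the integers both directions are available, so the same elimination also decides whether
-- suitable lengths exist, as the finite search demands. Homogeneity of the system is what allows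
-- denominators to be cleared.

record Con (k : ℕ) : Set where
  constructor con
  field
    strict  : Bool
    -- Two sides with natural coefficients, because in a monoid no term can be moved across the
    -- relation.
    lhs rhs : Fin k → ℕ

open Con

trivial : ∀ {k} → Con k
trivial = con false (λ _ → 0) (λ _ → 0)

tailCon : ∀ {k} → Con (suc k) → Con k
tailCon c = con (strict c) (lhs c ∘ suc) (rhs c ∘ suc)

lower upper : ∀ {k} → Con (suc k) → ℕ
lower c = rhs c zero ∸ lhs c zero
upper c = lhs c zero ∸ rhs c zero

IsLower IsUpper : ∀ {k} → Con (suc k) → Set
IsLower c = lhs c zero ℕ.< rhs c zero
IsUpper c = rhs c zero ℕ.< lhs c zero

isLower? : ∀ {k} (c : Con (suc k)) → Dec (IsLower c)
isLower? c = lhs c zero ℕ.<? rhs c zero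

isUpper? : ∀ {k} (c : Con (suc k)) → Dec (IsUpper c)
isUpper? c = rhs c zero ℕ.<? lhs c zero

-- The weights make the coefficients of variable 0 agree on the two sides (`cross`), so that it can
-- be cancelled. They are positive, hence one strict premise makes the result strict.
resolvent : ∀ {k} → Con (suc k) → Con (suc k) → Con k
resolvent c d = con (strict c ∨ strict d)
  (λ j → upper d ℕ.* lhs c (suc j) ℕ.+ lower c ℕ.* lhs d (suc j))
  (λ j → upper d ℕ.* rhs c (suc j) ℕ.+ lower c ℕ.* rhs d (suc j))

-- Pairs that bound the eliminated variable on one side only give a trivial constraint.
combine₂ : ∀ {k} → Con (suc k) → Con (suc k) → Con k
combine₂ c d with isLower? c | isUpper? d
... | yes _ | yes _ = resolvent c d
... | yes _ | no _  = trivial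
... | no _  | _     = trivial

dropEqual : ∀ {k} → Con (suc k) → Con k
dropEqual c with lhs c zero ℕ.≟ rhs c zero
... | yes _ = tailCon c
... | no _  = trivial

eliminate : ∀ {k} → List (Con (suc k)) → List (Con k)
eliminate S = map dropEqual S ++ cartesianProductWith combine₂ S S

-- What forward elimination uses of an order: adding constraints, cancelling the eliminated
-- variable, and refuting a strict constraint in which no variable is left. Indexing by `Bool`
-- treats strict and weak relations together, with strictness of a sum given by `∨`.
record Model {c ℓ} (A : CommutativeMonoid c ℓ) : Set (lsuc (c ⊔ ℓ)) where
  open CommutativeMonoid A
  field
    Rel        : Bool → Carrier → Carrier → Set (c ⊔ ℓ)
    Rel-resp   : ∀ {s x x′ y y′} → x ≈ x′ → y ≈ y′ → Rel s x y → Rel s x′ y′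
    Rel-refl   : ∀ {x} → Rel false x x
    Rel-∙      : ∀ {s t x y u v} → Rel s x y → Rel t u v → Rel (s ∨ t) (x ∙ u) (y ∙ v)
    Rel-cancel : ∀ {s} x {y z} → Rel s (x ∙ y) (x ∙ z) → Rel s y z
    Rel-irrefl : ∀ {x} → ¬ Rel true x x

module Linear {c ℓ} {A : CommutativeMonoid c ℓ} (mod : Model A) where
  open CommutativeMonoid A renaming (refl to ≈-refl; sym to ≈-sym; trans to ≈-trans)
  open Model mod
  open import Algebra.Properties.CommutativeMonoid.Mult A using (×-congˡ; ×-congʳ; ×-homo-+; ×-assocˡ; ×-distrib-+) renaming (_×_ to _⊗_) public
  open import Relation.Binary.Reasoning.Setoid setoid

  eval : ∀ {k} → (Fin k → ℕ) → (Fin k → Carrier) → Carrier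
  eval {zero}  a x = ε
  eval {suc k} a x = a zero ⊗ x zero ∙ eval (a ∘ suc) (x ∘ suc)

  Sat : ∀ {k} → Con k → (Fin k → Carrier) → Set (c ⊔ ℓ)
  Sat c x = Rel (strict c) (eval (lhs c) x) (eval (rhs c) x)

  Solves : ∀ {k} → List (Con k) → (Fin k → Carrier) → Set (c ⊔ ℓ)
  Solves S x = ∀ {c} → c ∈ S → Sat c x

  eval-linear : ∀ {k} p q (a b : Fin k → ℕ) x →
    eval (λ j → p ℕ.* a j ℕ.+ q ℕ.* b j) x ≈ p ⊗ eval a x ∙ q ⊗ eval b x
  eval-linear {zero}  p q a b x = ≈-sym (≈-trans (∙-cong (⊗ε p) (⊗ε q)) (identityˡ ε))
    where
    ⊗ε : ∀ n → n ⊗ ε ≈ ε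
    ⊗ε zero    = ≈-refl
    ⊗ε (suc n) = ≈-trans (identityˡ _) (⊗ε n)
  eval-linear {suc k} p q a b x = begin
    (p ℕ.* a zero ℕ.+ q ℕ.* b zero) ⊗ x₀ ∙ eval (λ j → p ℕ.* a (suc j) ℕ.+ q ℕ.* b (suc j)) x′
      ≈⟨ ∙-cong (×-homo-+ x₀ (p ℕ.* a zero) (q ℕ.* b zero)) (eval-linear p q (a ∘ suc) (b ∘ suc) x′) ⟩
    ((p ℕ.* a zero) ⊗ x₀ ∙ (q ℕ.* b zero) ⊗ x₀) ∙ (p ⊗ A′ ∙ q ⊗ B′)
      ≈⟨ interchange commutativeSemigroup _ _ _ _ ⟩
    ((p ℕ.* a zero) ⊗ x₀ ∙ p ⊗ A′) ∙ ((q ℕ.* b zero) ⊗ x₀ ∙ q ⊗ B′)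
      ≈⟨ ∙-cong (pull p (a zero) A′) (pull q (b zero) B′) ⟩
    p ⊗ (a zero ⊗ x₀ ∙ A′) ∙ q ⊗ (b zero ⊗ x₀ ∙ B′) ∎
    where
    x₀ = x zero
    x′ = x ∘ suc
    A′ = eval (a ∘ suc) x′
    B′ = eval (b ∘ suc) x′
    pull : ∀ m n y → (m ℕ.* n) ⊗ x₀ ∙ m ⊗ y ≈ m ⊗ (n ⊗ x₀ ∙ y)
    pull m n y = ≈-trans (∙-cong (≈-sym (×-assocˡ x₀ m n)) ≈-refl) (≈-sym (×-distrib-+ (n ⊗ x₀) y m))

  -- Positivity of `p` matters in the strict case: the zeroth multiple would relate `ε` strictly to
  -- itself.
  Rel-⊗ : ∀ {s x y} p → 0 ℕ.< p → Rel s x y → Rel s (p ⊗ x) (p ⊗ y)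
  Rel-⊗ {s} (suc zero)    _ r = Rel-resp (≈-sym (identityʳ _)) (≈-sym (identityʳ _)) r
  Rel-⊗ {s} (suc (suc p)) _ r = subst (λ t → Rel t _ _) (∨-idem s) (Rel-∙ r (Rel-⊗ (suc p) (ℕ.s≤s ℕ.z≤n) r))

  sat-trivial : ∀ {k} (x : Fin k → Carrier) → Sat trivial x
  sat-trivial x = Rel-refl

  sat-dropEqual : ∀ {k} (c : Con (suc k)) x → Sat c x → Sat (dropEqual c) (x ∘ suc)
  sat-dropEqual c x sat with lhs c zero ℕ.≟ rhs c zero
  ... | no _  = sat-trivial (x ∘ suc)
  ... | yes p = Rel-cancel (rhs c zero ⊗ x zero) (Rel-resp (∙-cong (×-congˡ p) ≈-refl) ≈-refl sat)

  -- Write p and q for the two weights. Then `lhs d` exceeds `rhs d` by p and `rhs c` exceeds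
  -- `lhs c` by q at variable 0, and both sides become p a + q b + p q.
  cross : ∀ {k} (c d : Con (suc k)) → IsLower c → IsUpper d →
    upper d ℕ.* lhs c zero ℕ.+ lower c ℕ.* lhs d zero ≡ upper d ℕ.* rhs c zero ℕ.+ lower c ℕ.* rhs d zero
  cross c d lc ud = trans
    (cong (λ t → upper d ℕ.* lhs c zero ℕ.+ lower c ℕ.* t) (sym (ℕₚ.m∸n+n≡m (ℕₚ.<⇒≤ ud))))
    (trans (balance (upper d) (lower c) (lhs c zero) (rhs d zero))
      (cong (λ t → upper d ℕ.* t ℕ.+ lower c ℕ.* rhs d zero) (ℕₚ.m∸n+n≡m (ℕₚ.<⇒≤ lc))))
    where
    balance : ∀ p q a b → p ℕ.* a ℕ.+ q ℕ.* (p ℕ.+ b) ≡ p ℕ.* (q ℕ.+ a) ℕ.+ q ℕ.* b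
    balance = ℕ-Ring.solve-∀

  sat-resolvent : ∀ {k} (c d : Con (suc k)) x → IsLower c → IsUpper d →
    Sat c x → Sat d x → Sat (resolvent c d) (x ∘ suc)
  sat-resolvent c d x lc ud sc sd = Rel-cancel (coef (rhs c) (rhs d) ⊗ x zero)
    (Rel-resp
      (≈-trans (≈-sym (eval-linear p q (lhs c) (lhs d) x)) (∙-cong (×-congˡ (cross c d lc ud)) ≈-refl))
      (≈-sym (eval-linear p q (rhs c) (rhs d) x))
      (Rel-∙ (Rel-⊗ p (ℕₚ.m<n⇒0<n∸m ud) sc) (Rel-⊗ q (ℕₚ.m<n⇒0<n∸m lc) sd)))
    where
    p = upper d
    q = lower c
    coef : (a b : Fin _ → ℕ) → ℕ
    coef a b = p ℕ.* a zero ℕ.+ q ℕ.* b zero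

  sat-combine₂ : ∀ {k} (c d : Con (suc k)) x → Sat c x → Sat d x → Sat (combine₂ c d) (x ∘ suc)
  sat-combine₂ c d x sc sd with isLower? c | isUpper? d
  ... | yes lc | yes ud = sat-resolvent c d x lc ud sc sd
  ... | yes _  | no _   = sat-trivial (x ∘ suc)
  ... | no _   | _      = sat-trivial (x ∘ suc)

  solves-eliminate : ∀ {k} (S : List (Con (suc k))) x → Solves S x → Solves (eliminate S) (x ∘ suc)
  solves-eliminate S x sol m with ∈-++⁻ (map dropEqual S) m
  ... | inj₁ m₁ with ∈-map⁻ dropEqual m₁
  ...   | c , c∈S , refl = sat-dropEqual c x (sol c∈S)
  solves-eliminate S x sol m | inj₂ m₂ with ∈-cartesianProductWith⁻ combine₂ S S m₂
  ...   | c , d , c∈S , d∈S , refl = sat-combine₂ c d x (sol c∈S) (sol d∈S)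

  -- With no variables both sides evaluate to `ε`, so irreflexivity excludes a strict constraint.
  -- This is all that a solution in the monoid finally tells.
  solves-unstrict : ∀ {S : List (Con 0)} x → Solves S x → ∀ c → c ∈ S → strict c ≡ false
  solves-unstrict x sol (con false _ _) m = refl
  solves-unstrict x sol (con true _ _)  m = contradiction (sol m) Rel-irrefl

-- The integers as a model

Sign : Bool → ℤ → Set
Sign true  z = + 0 < z
Sign false z = + 0 ≤ z

sign⇒≥0 : ∀ s {z} → Sign s z → + 0 ≤ z
sign⇒≥0 true  = ℤₚ.<⇒≤
sign⇒≥0 false p = p

>0⇒sign : ∀ s {z} → + 0 < z → Sign s z
>0⇒sign true  p = p
>0⇒sign false = ℤₚ.<⇒≤

sign-+ : ∀ s t {x y} → Sign s x → Sign t y → Sign (s ∨ t) (x + y)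
sign-+ true  t     p q = ℤₚ.+-mono-<-≤ p (sign⇒≥0 t q)
sign-+ false true  p q = ℤₚ.+-mono-≤-< p q
sign-+ false false p q = ℤₚ.+-mono-≤ p q

sign-+≥0 : ∀ s {x y} → Sign s x → + 0 ≤ y → Sign s (x + y)
sign-+≥0 true  p q = ℤₚ.+-mono-<-≤ p q
sign-+≥0 false p q = ℤₚ.+-mono-≤ p q

sign-* : ∀ s {a x} → + 0 < a → Sign s x → Sign s (a * x)
sign-* true  {+ suc a} {+ suc x} _ _ = +<+ (ℕ.s≤s ℕ.z≤n)
sign-* true  {+ suc a} {+ zero}  _ (+<+ ())
sign-* true  {+ zero}  (+<+ ()) _
sign-* false {+ suc a} {+ x}     _ _ = subst (+ 0 ≤_) (ℤₚ.pos-* (suc a) x) (+≤+ ℕ.z≤n)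
sign-* false {+ zero}  (+<+ ()) _

≥0-* : ∀ {a x} → + 0 ≤ a → + 0 ≤ x → + 0 ≤ a * x
≥0-* {+ a} {+ x} _ _ = subst (+ 0 ≤_) (ℤₚ.pos-* a x) (+≤+ ℕ.z≤n)

ℤ-model : Model ℤₚ.+-0-commutativeMonoid
ℤ-model = record
  { Rel        = λ s x y → Sign s (y - x)
  ; Rel-resp   = λ { refl refl p → p }
  ; Rel-refl   = λ {x} → ℤₚ.≤-reflexive (sym (ℤₚ.+-inverseʳ x))
  ; Rel-∙      = λ {s} {t} {x} {y} {u} {v} p q →
                   subst (Sign (s ∨ t)) (regroup x y u v) (sign-+ s t p q)
  ; Rel-cancel = λ {s} x {y} {z} → subst (Sign s) (dropˡ x y z)
  ; Rel-irrefl = λ {x} p → ℤₚ.<-irrefl (sym (ℤₚ.+-inverseʳ x)) p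
  }
  where
  regroup : ∀ x y u v → (y - x) + (v - u) ≡ (y + v) - (x + u)
  regroup = ℤ-Ring.solve-∀
  dropˡ : ∀ x y z → (x + z) - (x + y) ≡ z - y
  dropˡ = ℤ-Ring.solve-∀

open Linear ℤ-model using () renaming (eval to evalℤ; Sat to Satℤ; Solves to Solvesℤ; eval-linear to evalℤ-linear; solves-eliminate to solvesℤ-eliminate; solves-unstrict to solvesℤ-unstrict; _⊗_ to _⊗ℤ_)

⊗≡* : ∀ n z → n ⊗ℤ z ≡ + n * z
⊗≡* zero    z = sym (ℤₚ.*-zeroˡ z)
⊗≡* (suc n) z = trans (cong (λ t → z + t) (⊗≡* n z)) (sym (ℤₚ.suc-* (+ n) z))

evalℤ-scale : ∀ {k} N (a : Fin k → ℕ) x → evalℤ a (λ j → N * x j) ≡ N * evalℤ a x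
evalℤ-scale {zero}  N a x = sym (ℤₚ.*-zeroʳ N)
evalℤ-scale {suc k} N a x = begin
  a zero ⊗ℤ (N * x zero) + evalℤ (a ∘ suc) (λ j → N * x (suc j))
    ≡⟨ cong₂ _+_ (⊗≡* (a zero) (N * x zero)) (evalℤ-scale N (a ∘ suc) (x ∘ suc)) ⟩
  + a zero * (N * x zero) + N * evalℤ (a ∘ suc) (x ∘ suc)
    ≡⟨ factor (+ a zero) N (x zero) _ ⟩
  N * (+ a zero * x zero + evalℤ (a ∘ suc) (x ∘ suc))
    ≡⟨ cong (λ t → N * (t + evalℤ (a ∘ suc) (x ∘ suc))) (⊗≡* (a zero) (x zero)) ⟨
  N * (a zero ⊗ℤ x zero + evalℤ (a ∘ suc) (x ∘ suc)) ∎
  where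
  open ≡-Reasoning
  factor : ∀ a N x y → a * (N * x) + N * y ≡ N * (a * x + y)
  factor = ℤ-Ring.solve-∀

slack : ∀ {k} → Con k → (Fin k → ℤ) → ℤ
slack c x = evalℤ (rhs c) x - evalℤ (lhs c) x

_◂_ : ∀ {k} → ℤ → (Fin k → ℤ) → Fin (suc k) → ℤ
(x₀ ◂ x) zero    = x₀
(x₀ ◂ x) (suc j) = x j

slack-◂ : ∀ {k} (c : Con (suc k)) N x₀ x →
  slack c (x₀ ◂ (λ j → N * x j)) ≡ (+ rhs c zero - + lhs c zero) * x₀ + N * slack (tailCon c) x
slack-◂ c N x₀ x = trans
  (cong₂ _-_ (cong₂ _+_ (⊗≡* (rhs c zero) x₀) (evalℤ-scale N (rhs c ∘ suc) x))
             (cong₂ _+_ (⊗≡* (lhs c zero) x₀) (evalℤ-scale N (lhs c ∘ suc) x)))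
  (arrange (+ rhs c zero) (+ lhs c zero) N x₀ _ _)
  where
  arrange : ∀ b a N x₀ B A → (b * x₀ + N * B) - (a * x₀ + N * A) ≡ (b - a) * x₀ + N * (B - A)
  arrange = ℤ-Ring.solve-∀

slack-resolvent : ∀ {k} (c d : Con (suc k)) x →
  slack (resolvent c d) x ≡ + upper d * slack (tailCon c) x + + lower c * slack (tailCon d) x
slack-resolvent c d x = trans (cong₂ _-_ (side rhs) (side lhs)) (arrange (+ p) (+ q) _ _ _ _)
  where
  p = upper d
  q = lower c
  side : (f : ∀ {k} → Con k → Fin k → ℕ) →
    evalℤ (λ j → p ℕ.* f c (suc j) ℕ.+ q ℕ.* f d (suc j)) x
      ≡ + p * evalℤ (f c ∘ suc) x + + q * evalℤ (f d ∘ suc) x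
  side f = trans (evalℤ-linear p q (f c ∘ suc) (f d ∘ suc) x) (cong₂ _+_ (⊗≡* p _) (⊗≡* q _))
  arrange : ∀ p q B B′ A A′ → (p * B + q * B′) - (p * A + q * A′) ≡ p * (B - A) + q * (B′ - A′)
  arrange = ℤ-Ring.solve-∀

pos-∸ : ∀ {m n} → m ℕ.≤ n → + n - + m ≡ + (n ∸ m)
pos-∸ {m} {n} m≤n = trans (ℤₚ.m-n≡m⊖n n m) (ℤₚ.⊖-≥ m≤n)

-- Back-substitution over the integers

module _ {A : Set} (P : A → Set) (P? : ∀ a → Dec (P a)) (w ρ : A → ℤ) (w>0 : ∀ {a} → P a → + 0 < w a) where

  -- The fractions ρ / w are compared by cross-multiplication, which is transitive for positive
  -- weights once a common factor is cancelled (`chain`). A minimal fraction among the lower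
  -- constraints gives the greatest lower bound -ρ / w, among the upper ones the least upper bound ρ
  -- / w.
  minimalRatio : (S : List A) →
    (∀ {a} → a ∈ S → ¬ P a) ⊎
    (∃[ b ] (b ∈ S × P b × (∀ {a} → a ∈ S → P a → ρ b * w a ≤ ρ a * w b)))
  minimalRatio [] = inj₁ λ ()
  minimalRatio (s ∷ S) with P? s | minimalRatio S
  ... | no ¬p | inj₁ none = inj₁ λ { (here refl) → ¬p ; (there m) → none m }
  ... | no ¬p | inj₂ (b , b∈S , Pb , min) =
    inj₂ (b , there b∈S , Pb , λ { (here refl) Pa → contradiction Pa ¬p ; (there m) → min m })
  ... | yes p | inj₁ none =
    inj₂ (s , here refl , p , λ { (here refl) _ → ℤₚ.≤-refl ; (there m) Pa → contradiction Pa (none m) })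
  ... | yes p | inj₂ (b , b∈S , Pb , min) with ℤₚ.≤-total (ρ b * w s) (ρ s * w b)
  ...   | inj₁ le = inj₂ (b , there b∈S , Pb , λ { (here refl) _ → le ; (there m) → min m })
  ...   | inj₂ ge = inj₂ (s , here refl , p ,
            λ { (here refl) _ → ℤₚ.≤-refl ; {a} (there m) Pa → chain Pa (min m Pa) })
    where
    swapʳ : ∀ x y z → (x * y) * z ≡ (x * z) * y
    swapʳ = ℤ-Ring.solve-∀
    chain : ∀ {a} → P a → ρ b * w a ≤ ρ a * w b → ρ s * w a ≤ ρ a * w s
    chain {a} Pa le = ℤₚ.*-cancelʳ-≤-pos (ρ s * w a) (ρ a * w s) (w b) {{ℤ.positive (w>0 Pb)}} (begin
      ρ s * w a * w b ≡⟨ swapʳ (ρ s) (w a) (w b) ⟩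
      ρ s * w b * w a ≤⟨ ℤₚ.*-monoʳ-≤-nonNeg (w a) {{ℤ.nonNegative (ℤₚ.<⇒≤ (w>0 Pa))}} ge ⟩
      ρ b * w s * w a ≡⟨ swapʳ (ρ b) (w s) (w a) ⟩
      ρ b * w a * w s ≤⟨ ℤₚ.*-monoʳ-≤-nonNeg (w s) {{ℤ.nonNegative (ℤₚ.<⇒≤ (w>0 p))}} le ⟩
      ρ a * w b * w s ≡⟨ swapʳ (ρ a) (w b) (w s) ⟩
      ρ a * w s * w b ∎)
      where open ℤₚ.≤-Reasoning

module Lift {k} (S : List (Con (suc k))) (x : Fin k → ℤ) (sol : Solvesℤ (eliminate S) x) where

  ρ lo up : Con (suc k) → ℤ
  ρ c  = slack (tailCon c) x
  lo c = + lower c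
  up c = + upper c

  lo>0 : ∀ c → IsLower c → + 0 < lo c
  lo>0 c l = +<+ (ℕₚ.m<n⇒0<n∸m l)

  up>0 : ∀ c → IsUpper c → + 0 < up c
  up>0 c u = +<+ (ℕₚ.m<n⇒0<n∸m u)

  pair : ∀ {c d} → c ∈ S → d ∈ S → IsLower c → IsUpper d →
    Sign (strict c ∨ strict d) (up d * ρ c + lo c * ρ d)
  pair {c} {d} c∈S d∈S lc ud = subst (Sign _) (slack-resolvent c d x) (recover (sol (∈-++⁺ʳ (map dropEqual S) (∈-cartesianProductWith⁺ combine₂ c∈S d∈S))))
    where
    recover : Satℤ (combine₂ c d) x → Satℤ (resolvent c d) x
    recover with isLower? c | isUpper? d
    ... | yes _  | yes _  = λ s → s
    ... | yes _  | no ¬ud = contradiction ud ¬ud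
    ... | no ¬lc | _      = contradiction lc ¬lc

  equal : ∀ {c} → c ∈ S → lhs c zero ≡ rhs c zero → Sign (strict c) (ρ c)
  equal {c} c∈S eq = recover (sol (∈-++⁺ˡ (∈-map⁺ dropEqual c∈S)))
    where
    recover : Satℤ (dropEqual c) x → Satℤ (tailCon c) x
    recover with lhs c zero ℕ.≟ rhs c zero
    ... | yes _  = λ s → s
    ... | no ¬eq = contradiction eq ¬eq

  -- -ρL / dL is a greatest lower bound and ρU / dU a least upper bound for the eliminated variable.
  record Bounds : Set where
    field
      dL ρL dU ρU : ℤ
      dL>0     : + 0 < dL
      dU>0     : + 0 < dU
      lowest   : ∀ {c} → c ∈ S → IsLower c → ρL * lo c ≤ ρ c * dL
      highest  : ∀ {c} → c ∈ S → IsUpper c → ρU * up c ≤ ρ c * dU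
      below-U  : ∀ {c} → c ∈ S → IsLower c → Sign (strict c) (dU * ρ c + lo c * ρU)
      above-L  : ∀ {c} → c ∈ S → IsUpper c → Sign (strict c) (dL * ρ c + up c * ρL)

  ∨-weakenˡ : ∀ s t {z} → Sign (s ∨ t) z → Sign s z
  ∨-weakenˡ true  t p = p
  ∨-weakenˡ false t p = sign⇒≥0 t p

  ∨-weakenʳ : ∀ s t {z} → Sign (s ∨ t) z → Sign t z
  ∨-weakenʳ true  t p = >0⇒sign t p
  ∨-weakenʳ false t p = p

  >0-* : ∀ {a b} → + 0 < a → + 0 < b → + 0 < a * b
  >0-* = sign-* true

  -- If one side is unbounded, the missing bound is placed at distance 1 from the existing one.
  offset : ∀ s {d r w y} → + 0 < d → + 0 < w → r * w ≤ y * d → Sign s (d * y + w * (d - r))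
  offset s {d} {r} {w} {y} d>0 w>0 le = subst (Sign s) (arrange d r w y)
    (sign-+≥0 s (>0⇒sign s (>0-* w>0 d>0)) (ℤₚ.i≤j⇒0≤j-i le))
    where
    arrange : ∀ d r w y → w * d + (y * d - r * w) ≡ d * y + w * (d - r)
    arrange = ℤ-Ring.solve-∀

  bounds : Bounds
  bounds with minimalRatio IsLower isLower? lo ρ (λ {c} → lo>0 c) S | minimalRatio IsUpper isUpper? up ρ (λ {c} → up>0 c) S
  ... | inj₁ ¬l | inj₁ ¬u = record
    { dL = + 1 ; ρL = + 0 ; dU = + 1 ; ρU = + 0
    ; dL>0 = +<+ (ℕ.s≤s ℕ.z≤n) ; dU>0 = +<+ (ℕ.s≤s ℕ.z≤n)
    ; lowest = λ m l → contradiction l (¬l m) ; highest = λ m u → contradiction u (¬u m)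
    ; below-U = λ m l → contradiction l (¬l m) ; above-L = λ m u → contradiction u (¬u m) }
  ... | inj₂ (a , a∈S , la , min) | inj₁ ¬u = record
    { dL = lo a ; ρL = ρ a ; dU = lo a ; ρU = lo a - ρ a
    ; dL>0 = lo>0 a la ; dU>0 = lo>0 a la
    ; lowest = min ; highest = λ m u → contradiction u (¬u m)
    ; below-U = λ {c} m l → offset (strict c) {r = ρ a} {y = ρ c} (lo>0 a la) (lo>0 c l) (min m l) ; above-L = λ m u → contradiction u (¬u m) }
  ... | inj₁ ¬l | inj₂ (b , b∈S , ub , min) = record
    { dL = up b ; ρL = up b - ρ b ; dU = up b ; ρU = ρ b
    ; dL>0 = up>0 b ub ; dU>0 = up>0 b ub
    ; lowest = λ m l → contradiction l (¬l m) ; highest = min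
    ; below-U = λ m l → contradiction l (¬l m) ; above-L = λ {c} m u → offset (strict c) {r = ρ b} {y = ρ c} (up>0 b ub) (up>0 c u) (min m u) }
  ... | inj₂ (a , a∈S , la , minL) | inj₂ (b , b∈S , ub , minU) = record
    { dL = lo a ; ρL = ρ a ; dU = up b ; ρU = ρ b
    ; dL>0 = lo>0 a la ; dU>0 = up>0 b ub
    ; lowest = minL ; highest = minU
    ; below-U = λ {c} m l → ∨-weakenˡ (strict c) (strict b) (pair m b∈S l ub)
    ; above-L = λ {c} m u → ∨-weakenʳ (strict a) (strict c)
        (subst (Sign (strict a ∨ strict c)) (ℤₚ.+-comm (up c * ρ a) (lo a * ρ c)) (pair a∈S m la u)) }

  open Bounds bounds

  -- x₀ / N is the midpoint of the two bounds. Instead of dividing by N, the remaining variables are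
  -- multiplied by it.
  N x₀ : ℤ
  N  = + 2 * (dL * dU)
  x₀ = ρU * dL - ρL * dU

  N>0 : + 0 < N
  N>0 = >0-* {+ 2} (+<+ (ℕ.s≤s ℕ.z≤n)) (>0-* dL>0 dU>0)

  -- Up to a positive factor, twice the distance from a constraint's own lower bound to the midpoint
  -- is its distance to the upper bound plus its distance to the greatest lower bound. The first
  -- summand carries the strictness (`below-U`), the second is nonnegative (`lowest`). `upper-slack`
  -- is the mirror image.
  lower-slack : ∀ d r → dL * (dU * r + d * ρU) + dU * (r * dL - ρL * d) ≡ d * x₀ + N * r
  lower-slack d r = identity dL dU ρL ρU d r
    where
    identity : ∀ a b p q d r → a * (b * r + d * q) + b * (r * a - p * d) ≡ d * (q * a - p * b) + + 2 * (a * b) * r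
    identity = ℤ-Ring.solve-∀

  upper-slack : ∀ e r → dU * (dL * r + e * ρL) + dL * (r * dU - ρU * e) ≡ - e * x₀ + N * r
  upper-slack e r = identity dL dU ρL ρU e r
    where
    identity : ∀ a b p q e r → b * (a * r + e * p) + a * (r * b - q * e) ≡ - e * (q * a - p * b) + + 2 * (a * b) * r
    identity = ℤ-Ring.solve-∀

  solution : Fin (suc k) → ℤ
  solution = x₀ ◂ (λ j → N * x j)

  solves : Solvesℤ S solution
  solves {c} c∈S = subst (Sign (strict c)) (sym (slack-◂ c N x₀ x)) (cases (ℕₚ.<-cmp (lhs c zero) (rhs c zero)))
    where
    cases : Tri _ _ _ → Sign (strict c) ((+ rhs c zero - + lhs c zero) * x₀ + N * ρ c)
    cases (tri< l _ _) = subst (λ d → Sign (strict c) (d * x₀ + N * ρ c)) (sym (pos-∸ (ℕₚ.<⇒≤ l)))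
      (subst (Sign (strict c)) (lower-slack (lo c) (ρ c))
        (sign-+≥0 (strict c) (sign-* (strict c) dL>0 (below-U c∈S l)) (≥0-* (ℤₚ.<⇒≤ dU>0) (ℤₚ.i≤j⇒0≤j-i (lowest c∈S l)))))
    cases (tri≈ _ eq _) = subst (Sign (strict c)) (sym (cancel₀ eq)) (sign-* (strict c) N>0 (equal c∈S eq))
      where
      cancel₀ : lhs c zero ≡ rhs c zero → (+ rhs c zero - + lhs c zero) * x₀ + N * ρ c ≡ N * ρ c
      cancel₀ eq = trans (cong (λ t → (+ rhs c zero - + t) * x₀ + N * ρ c) eq) (vanish (+ rhs c zero) x₀ (N * ρ c))
        where
        vanish : ∀ a x y → (a - a) * x + y ≡ y
        vanish = ℤ-Ring.solve-∀
    cases (tri> _ _ u) = subst (λ d → Sign (strict c) (d * x₀ + N * ρ c)) (sym (trans (flip (+ rhs c zero) (+ lhs c zero)) (cong -_ (pos-∸ (ℕₚ.<⇒≤ u)))))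
      (subst (Sign (strict c)) (upper-slack (up c) (ρ c))
        (sign-+≥0 (strict c) (sign-* (strict c) dU>0 (above-L c∈S u)) (≥0-* (ℤₚ.<⇒≤ dL>0) (ℤₚ.i≤j⇒0≤j-i (highest c∈S u)))))
      where
      flip : ∀ a b → a - b ≡ - (b - a)
      flip = ℤ-Ring.solve-∀

lift : ∀ {k} (S : List (Con (suc k))) → ∃ (Solvesℤ (eliminate S)) → ∃ (Solvesℤ S)
lift S (x , sol) = Lift.solution S x sol , Lift.solves S x sol

noVariables : {S : List (Con 0)} → (∀ c → c ∈ S → strict c ≡ false) → ∃ (Solvesℤ S)
noVariables weak = (λ ()) , λ {c} m → subst (λ s → Sign s (+ 0)) (sym (weak c m)) ℤₚ.≤-refl

module _ {c ℓ} {A : CommutativeMonoid c ℓ} (mod : Model A) where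
  open Linear mod

  -- The recursion descends with solutions in the monoid and returns with solutions in the integers;
  -- the exchange takes place at zero variables, where only strictness flags are compared.
  transfer : ∀ {k} (S : List (Con k)) x → Solves S x → ∃ (Solvesℤ S)
  transfer {zero}  S x sol = noVariables (solves-unstrict {S} x sol)
  transfer {suc k} S x sol = lift S (transfer (eliminate S) (x ∘ suc) (solves-eliminate S x sol))

allWeak? : (S : List (Con 0)) → Dec (∀ c → c ∈ S → strict c ≡ false)
allWeak? [] = yes λ _ ()
allWeak? (con true _ _ ∷ S) = no λ f → contradiction (f _ (here refl)) λ ()
allWeak? (con false _ _ ∷ S) = map′ (λ f → λ { _ (here refl) → refl ; c (there m) → f c m }) (λ f c m → f c (there m)) (allWeak? S)

-- Over the integers elimination preserves solvability in both directions, so the question reduces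
-- to the strictness flags of the variable-free system.
solvable? : ∀ {k} (S : List (Con k)) → Dec (∃ (Solvesℤ S))
solvable? {zero}  S = map′ noVariables (λ (x , sol) → solvesℤ-unstrict {S} x sol) (allWeak? S)
solvable? {suc k} S = map′ (lift S) (λ (x , sol) → x ∘ suc , solvesℤ-eliminate S x sol) (solvable? (eliminate S))

-- Finite sums

sumℤ-cong : ∀ {n} {f g : Fin n → ℤ} → (∀ x → f x ≡ g x) → sumℤ f ≡ sumℤ g
sumℤ-cong {zero}  eq = refl
sumℤ-cong {suc n} eq = cong₂ _+_ (eq zero) (sumℤ-cong (eq ∘ suc))

sumℤ-mono : ∀ {n} {f g : Fin n → ℤ} → (∀ x → f x ≤ g x) → sumℤ f ≤ sumℤ g
sumℤ-mono {zero}  le = ℤₚ.≤-refl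
sumℤ-mono {suc n} le = ℤₚ.+-mono-≤ (le zero) (sumℤ-mono (le ∘ suc))

sumℤ-+ : ∀ {n} (f g : Fin n → ℤ) → sumℤ (λ x → f x + g x) ≡ sumℤ f + sumℤ g
sumℤ-+ {zero}  f g = refl
sumℤ-+ {suc n} f g = trans (cong (λ t → f zero + g zero + t) (sumℤ-+ (f ∘ suc) (g ∘ suc)))
  (exchange (f zero) (g zero) _ _)
  where
  exchange : ∀ a b c d → (a + b) + (c + d) ≡ (a + c) + (b + d)
  exchange = ℤ-Ring.solve-∀

sumℤ-* : ∀ {n} a (f : Fin n → ℤ) → sumℤ (λ x → a * f x) ≡ a * sumℤ f
sumℤ-* {zero}  a f = sym (ℤₚ.*-zeroʳ a)
sumℤ-* {suc n} a f = trans (cong (λ t → a * f zero + t) (sumℤ-* a (f ∘ suc))) (sym (ℤₚ.*-distribˡ-+ a (f zero) _))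

sumℤ-0 : ∀ {n} {f : Fin n → ℤ} → (∀ x → f x ≡ + 0) → sumℤ f ≡ + 0
sumℤ-0 {zero}  eq = refl
sumℤ-0 {suc n} eq = cong₂ _+_ (eq zero) (sumℤ-0 (eq ∘ suc))

sumℤ-≥0 : ∀ {n} {f : Fin n → ℤ} → (∀ x → + 0 ≤ f x) → + 0 ≤ sumℤ f
sumℤ-≥0 {n} {f} f≥0 = subst (_≤ sumℤ f) (sumℤ-0 {n} {λ _ → + 0} λ _ → refl) (sumℤ-mono f≥0)

sumℤ≡sum : ∀ {n} (f : Fin n → ℤ) → sumℤ f ≡ sum f
sumℤ≡sum {zero}  f = refl
sumℤ≡sum {suc n} f = cong (λ t → f zero + t) (sumℤ≡sum (f ∘ suc))

sumℤ-comm : ∀ {m n} (f : Fin m → Fin n → ℤ) → sumℤ (λ x → sumℤ (f x)) ≡ sumℤ (λ y → sumℤ (λ x → f x y))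
sumℤ-comm f = trans (double f) (trans (∑-comm f) (sym (double (λ y x → f x y))))
  where
  double : ∀ {m n} (f : Fin m → Fin n → ℤ) → sumℤ (λ x → sumℤ (f x)) ≡ sum (λ x → sum (f x))
  double f = trans (sumℤ-cong (λ x → sumℤ≡sum (f x))) (sumℤ≡sum (λ x → sum (f x)))

sumℤ-involution : ∀ {n} (i : Fin n → Fin n) → (∀ x → i (i x) ≡ x) → (f : Fin n → ℤ) → sumℤ (f ∘ i) ≡ sumℤ f
sumℤ-involution i invol f = trans (sumℤ≡sum (f ∘ i))
  (sym (trans (sumℤ≡sum f) (sum-permute f (permutation i i invol invol))))

sumℤ-point : ∀ {n} (a : Fin n) (f : Fin n → ℤ) → sumℤ (λ x → if does (a ≟ x) then f x else + 0) ≡ f a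
sumℤ-point {suc n} zero f = trans (cong (λ t → f zero + t) (sumℤ-0 {n} λ _ → refl)) (ℤₚ.+-identityʳ (f zero))
sumℤ-point (suc a) f = trans (ℤₚ.+-identityˡ _) (sumℤ-point a (f ∘ suc))

sumℤ-≥term : ∀ {n} (a : Fin n) (f : Fin n → ℤ) → (∀ x → + 0 ≤ f x) → f a ≤ sumℤ f
sumℤ-≥term a f f≥0 = subst (_≤ sumℤ f) (sumℤ-point a f) (sumℤ-mono le)
  where
  le : ∀ x → (if does (a ≟ x) then f x else + 0) ≤ f x
  le x with a ≟ x
  ... | yes _ = ℤₚ.≤-refl
  ... | no _  = f≥0 x

sumℤ-≥pair : ∀ {n} (a b : Fin n) → a ≢ b → (f : Fin n → ℤ) → (∀ x → + 0 ≤ f x) → f a + f b ≤ sumℤ f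
sumℤ-≥pair a b a≢b f f≥0 = subst (_≤ sumℤ f)
  (trans (sumℤ-+ (at a) (at b)) (cong₂ _+_ (sumℤ-point a f) (sumℤ-point b f))) (sumℤ-mono le)
  where
  at : Fin _ → Fin _ → ℤ
  at c x = if does (c ≟ x) then f x else + 0
  le : ∀ x → at a x + at b x ≤ f x
  le x with a ≟ x | b ≟ x
  ... | yes refl | yes refl = contradiction refl a≢b
  ... | yes _    | no _     = ℤₚ.≤-reflexive (ℤₚ.+-identityʳ (f x))
  ... | no _     | yes _    = ℤₚ.≤-reflexive (ℤₚ.+-identityˡ (f x))
  ... | no _     | no _     = f≥0 x

-- Integral piecewise linear functions and their Laplacians

Lap : ∀ {n} → Graph n → (Fin n → ℤ) → Fin n → ℤ
Lap = lap ℕ+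

record Lengths {n} (G : Graph n) : Set where
  open Graph G
  field
    len     : Fin n → ℕ
    len>0   : ∀ e → i e ≢ e → 0 ℕ.< len e
    len-sym : ∀ e → i e ≢ e → len (i e) ≡ len e

module _ {n} (G : Graph n) where
  open Graph G

  halfEdge-i : ∀ {e} → i e ≢ e → i (i e) ≢ i e
  halfEdge-i {e} h eq = h (trans (sym eq) (i-invol e))

  r-vertex : ∀ e → i (r e) ≡ r e
  r-vertex e = fix-r⇒i (r e) (r-idem e)

  IsPL : (Fin n → ℕ) → (Fin n → ℤ) → (Fin n → ℤ) → Set
  IsPL len g q = ∀ e → i e ≢ e → g (r e) - g (r (i e)) ≡ q e * + len e

  slope-antisym : (L : Lengths G) → ∀ {g q} → IsPL (Lengths.len L) g q → ∀ e → i e ≢ e → q (i e) ≡ - q e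
  slope-antisym L {g} {q} pl e h = ℤₚ.*-cancelʳ-≡ (q (i e)) (- q e) (+ len e) {{ℤ.≢-nonZero (λ eq → ℕₚ.<-irrefl (sym (ℤₚ.+-injective eq)) (len>0 e h))}} (begin
    q (i e) * + len e             ≡⟨ cong (λ t → q (i e) * + t) (len-sym e h) ⟨
    q (i e) * + len (i e)         ≡⟨ pl (i e) (halfEdge-i h) ⟨
    g (r (i e)) - g (r (i (i e))) ≡⟨ cong (λ t → g (r (i e)) - g (r t)) (i-invol e) ⟩
    g (r (i e)) - g (r e)         ≡⟨ flip (g (r (i e))) (g (r e)) ⟩
    - (g (r e) - g (r (i e)))     ≡⟨ cong -_ (pl e h) ⟩
    - (q e * + len e)             ≡⟨ ℤₚ.neg-distribˡ-* (q e) (+ len e) ⟩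
    - q e * + len e               ∎)
    where
    open Lengths L
    open ≡-Reasoning
    flip : ∀ a b → a - b ≡ - (b - a)
    flip = ℤ-Ring.solve-∀

  lap-cong : ∀ {q q′ : Fin n → ℤ} → (∀ e → i e ≢ e → q e ≡ q′ e) → ∀ v → Lap G q v ≡ Lap G q′ v
  lap-cong {q} {q′} eq v = sumℤ-cong term
    where
    term : ∀ e → (if does (r e ≟ v) ∧ not (does (i e ≟ e)) then q e else + 0)
               ≡ (if does (r e ≟ v) ∧ not (does (i e ≟ e)) then q′ e else + 0)
    term e with r e ≟ v | i e ≟ e
    ... | no _  | _     = refl
    ... | yes _ | yes _ = refl
    ... | yes _ | no h  = eq e h

  lap-mono : ∀ {q q′ : Fin n → ℤ} v → (∀ e → r e ≡ v → i e ≢ e → q e ≤ q′ e) → Lap G q v ≤ Lap G q′ v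
  lap-mono {q} {q′} v le = sumℤ-mono term
    where
    term : ∀ e → (if does (r e ≟ v) ∧ not (does (i e ≟ e)) then q e else + 0)
               ≤ (if does (r e ≟ v) ∧ not (does (i e ≟ e)) then q′ e else + 0)
    term e with r e ≟ v | i e ≟ e
    ... | no _  | _     = ℤₚ.≤-refl
    ... | yes _ | yes _ = ℤₚ.≤-refl
    ... | yes p | no h  = le e p h

  lap-≥term : ∀ {q : Fin n → ℤ} v → (∀ e → r e ≡ v → i e ≢ e → + 0 ≤ q e) →
    ∀ b → r b ≡ v → i b ≢ b → q b ≤ Lap G q v
  lap-≥term {q} v q≥0 b rb h = subst (_≤ Lap G q v) (value b rb h) (sumℤ-≥term b summand summand≥0)
    where
    summand : Fin n → ℤ
    summand e = if does (r e ≟ v) ∧ not (does (i e ≟ e)) then q e else + 0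
    value : ∀ e → r e ≡ v → i e ≢ e → summand e ≡ q e
    value e re he with r e ≟ v | i e ≟ e
    ... | no ¬p | _     = contradiction re ¬p
    ... | yes _ | yes p = contradiction p he
    ... | yes _ | no _  = refl
    summand≥0 : ∀ e → + 0 ≤ summand e
    summand≥0 e with r e ≟ v | i e ≟ e
    ... | no _  | _     = ℤₚ.≤-refl
    ... | yes _ | yes _ = ℤₚ.≤-refl
    ... | yes p | no he = q≥0 e p he

  lap-0 : ∀ v → Lap G (λ _ → + 0) v ≡ + 0
  lap-0 v = sumℤ-0 λ e → if-same (does (r e ≟ v) ∧ not (does (i e ≟ e)))
    where
    if-same : ∀ b → (if b then + 0 else + 0) ≡ + 0
    if-same true  = refl
    if-same false = refl

  lap-nonvertex : ∀ q x → i x ≢ x → Lap G q x ≡ + 0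
  lap-nonvertex q x h = sumℤ-0 term
    where
    term : ∀ e → (if does (r e ≟ x) ∧ not (does (i e ≟ e)) then q e else + 0) ≡ + 0
    term e with r e ≟ x
    ... | no _     = refl
    ... | yes refl = contradiction (r-vertex e) h

  lap-- : ∀ q q′ v → Lap G (λ e → q e - q′ e) v ≡ Lap G q v - Lap G q′ v
  lap-- q q′ v = trans (trans (sumℤ-cong term) (sumℤ-+ (summand q) (λ e → - + 1 * summand q′ e)))
    (trans (cong (λ t → Lap G q v + t) (sumℤ-* (- + 1) (summand q′))) (cong (λ t → Lap G q v + t) (ℤₚ.-1*i≡-i (Lap G q′ v))))
    where
    summand : (Fin n → ℤ) → Fin n → ℤ
    summand q e = if does (r e ≟ v) ∧ not (does (i e ≟ e)) then q e else + 0
    term : ∀ e → summand (λ e → q e - q′ e) e ≡ summand q e + - + 1 * summand q′ e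
    term e with does (r e ≟ v) ∧ not (does (i e ≟ e))
    ... | true  = cong (λ t → q e + t) (sym (ℤₚ.-1*i≡-i (q′ e)))
    ... | false = refl

  sum-lap : ∀ (χ q : Fin n → ℤ) →
    sumℤ (λ x → χ x * Lap G q x) ≡ sumℤ (λ e → if not (does (i e ≟ e)) then χ (r e) * q e else + 0)
  sum-lap χ q = begin
    sumℤ (λ x → χ x * sumℤ (summand x))
      ≡⟨ sumℤ-cong (λ x → sumℤ-* (χ x) (summand x)) ⟨
    sumℤ (λ x → sumℤ (λ e → χ x * summand x e))
      ≡⟨ sumℤ-comm (λ x e → χ x * summand x e) ⟩
    sumℤ (λ e → sumℤ (λ x → χ x * summand x e))
      ≡⟨ sumℤ-cong (λ e → trans (sumℤ-cong (term e)) (sumℤ-point (r e) _)) ⟩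
    sumℤ (λ e → if not (does (i e ≟ e)) then χ (r e) * q e else + 0) ∎
    where
    open ≡-Reasoning
    summand : Fin n → Fin n → ℤ
    summand x e = if does (r e ≟ x) ∧ not (does (i e ≟ e)) then q e else + 0
    term : ∀ e x → χ x * summand x e
      ≡ (if does (r e ≟ x) then (if not (does (i e ≟ e)) then χ x * q e else + 0) else + 0)
    term e x with does (r e ≟ x) | does (i e ≟ e)
    ... | true  | true  = ℤₚ.*-zeroʳ (χ x)
    ... | true  | false = refl
    ... | false | _     = ℤₚ.*-zeroʳ (χ x)

  -- Summation by parts: the terms of e and i e combine by antisymmetry. Doubling lets the sum run
  -- over all half-edges without orienting the edges. If χ is the indicator of a vertex set, the
  -- right side is twice the flow across its boundary.
  double-sum-lap : (χ q : Fin n → ℤ) → (∀ e → i e ≢ e → q (i e) ≡ - q e) →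
    sumℤ (λ x → χ x * Lap G q x) + sumℤ (λ x → χ x * Lap G q x)
      ≡ sumℤ (λ e → if not (does (i e ≟ e)) then (χ (r e) - χ (r (i e))) * q e else + 0)
  double-sum-lap χ q anti = begin
    sumℤ (λ x → χ x * Lap G q x) + sumℤ (λ x → χ x * Lap G q x)
      ≡⟨ cong₂ _+_ (sum-lap χ q) (trans (sum-lap χ q) (sym (sumℤ-involution i i-invol F))) ⟩
    sumℤ F + sumℤ (F ∘ i)
      ≡⟨ sumℤ-+ F (F ∘ i) ⟨
    sumℤ (λ e → F e + F (i e))
      ≡⟨ sumℤ-cong term ⟩
    sumℤ (λ e → if not (does (i e ≟ e)) then (χ (r e) - χ (r (i e))) * q e else + 0) ∎
    where
    open ≡-Reasoning
    F : Fin n → ℤ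
    F e = if not (does (i e ≟ e)) then χ (r e) * q e else + 0
    collect : ∀ a b c → a * c + b * (- c) ≡ (a - b) * c
    collect = ℤ-Ring.solve-∀
    term : ∀ e → F e + F (i e) ≡ (if not (does (i e ≟ e)) then (χ (r e) - χ (r (i e))) * q e else + 0)
    term e with i e ≟ e | i (i e) ≟ i e
    ... | yes _ | yes _ = refl
    ... | yes p | no h  = contradiction (cong i p) h
    ... | no h  | yes p = contradiction p (halfEdge-i h)
    ... | no h  | no _  = trans (cong (λ t → χ (r e) * q e + χ (r (i e)) * t) (anti e h))
                                (collect (χ (r e)) (χ (r (i e))) (q e))

  deg-lap : (q : Fin n → ℤ) → (∀ e → i e ≢ e → q (i e) ≡ - q e) → sumℤ (Lap G q) ≡ + 0
  deg-lap q anti = half (trans (cong (λ t → t + t) (sumℤ-cong λ x → sym (ℤₚ.*-identityˡ (Lap G q x))))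
    (trans (double-sum-lap (λ _ → + 1) q anti) (sumℤ-0 λ e → if-zero (not (does (i e ≟ e))) {q e})))
    where
    if-zero : ∀ b {z} → (if b then (+ 1 - + 1) * z else + 0) ≡ + 0
    if-zero true  {z} = ℤₚ.*-zeroˡ z
    if-zero false = refl
    half : ∀ {z} → z + z ≡ + 0 → z ≡ + 0
    half {+ zero} _ = refl

  -- The chips crossing the boundary of the level set {g ≥ g (r e)} all flow inwards, at least q e of them along e.
  slope≤deg : (L : Lengths G) → ∀ {g q} → IsPL (Lengths.len L) g q →
    (D : Fin n → ℤ) → (∀ x → + 0 ≤ D x) → (∀ x → + 0 ≤ D x + Lap G q x) →
    ∀ e → i e ≢ e → q e ≤ sumℤ D
  slope≤deg L {g} {q} pl D D≥0 E≥0 e₀ h₀ with q e₀ ℤₚ.≤? + 0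
  ... | yes q≤0 = ℤₚ.≤-trans q≤0 (sumℤ-≥0 D≥0)
  ... | no q≰0  = halve (begin
    q e₀ + q e₀                    ≡⟨ cong₂ _+_ (sym T-e₀) (sym T-ie₀) ⟩
    -- In the doubled sum the edge appears through both of its half-edges, each time with the value
    -- `q e₀`; all other terms are nonnegative.
    T e₀ + T (i e₀)                ≤⟨ sumℤ-≥pair e₀ (i e₀) (h₀ ∘ sym) T T≥0 ⟩
    sumℤ T                         ≡⟨ double-sum-lap χ q anti ⟨
    sumℤ (λ x → χ x * Lap G q x) + sumℤ (λ x → χ x * Lap G q x)
                                   ≤⟨ ℤₚ.+-mono-≤ flow≤ flow≤ ⟩
    sumℤ D + sumℤ D                ∎)
    where
    open ℤₚ.≤-Reasoning
    open Lengths L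
    t : ℤ
    t = g (r e₀)
    anti = slope-antisym L {g} {q} pl
    χ : Fin n → ℤ
    χ x = if does (t ℤₚ.≤? g x) then + 1 else + 0
    T : Fin n → ℤ
    T e = if not (does (i e ≟ e)) then (χ (r e) - χ (r (i e))) * q e else + 0

    slope≥0 : ∀ e → i e ≢ e → g (r (i e)) ≤ g (r e) → + 0 ≤ q e
    slope≥0 e h le = ℤₚ.*-cancelʳ-≤-pos (+ 0) (q e) (+ len e) {{ℤ.positive (+<+ (len>0 e h))}}
      (subst₂ _≤_ (sym (ℤₚ.*-zeroˡ (+ len e))) (pl e h) (ℤₚ.i≤j⇒0≤j-i le))

    slope>0⇒< : ∀ e → i e ≢ e → + 0 < q e → g (r (i e)) < g (r e)
    slope>0⇒< e h pos = ℤₚ.≰⇒> λ le → ℤₚ.<⇒≱ pos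
      (subst (_≤ + 0) (trans (cong -_ (anti e h)) (ℤₚ.neg-involutive (q e)))
        (ℤₚ.neg-mono-≤ (slope≥0 (i e) (halfEdge-i h) (subst (λ x → g (r x) ≤ g (r (i e))) (sym (i-invol e)) le))))

    T≥0 : ∀ e → + 0 ≤ T e
    T≥0 e with i e ≟ e
    ... | yes _ = ℤₚ.≤-refl
    ... | no h with t ℤₚ.≤? g (r e) | t ℤₚ.≤? g (r (i e))
    ...   | yes _ | yes _ = ℤₚ.≤-reflexive (sym (ℤₚ.*-zeroˡ (q e)))
    ...   | no _  | no _  = ℤₚ.≤-reflexive (sym (ℤₚ.*-zeroˡ (q e)))
    ...   | yes p | no ¬p = subst (+ 0 ≤_) (sym (ℤₚ.*-identityˡ (q e)))
              (slope≥0 e h (ℤₚ.≤-trans (ℤₚ.<⇒≤ (ℤₚ.≰⇒> ¬p)) p))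
    ...   | no ¬p | yes p = subst (+ 0 ≤_) (trans (anti e h) (sym (ℤₚ.-1*i≡-i (q e))))
              (slope≥0 (i e) (halfEdge-i h) (subst (λ x → g (r x) ≤ g (r (i e))) (sym (i-invol e))
                (ℤₚ.≤-trans (ℤₚ.<⇒≤ (ℤₚ.≰⇒> ¬p)) p)))

    χ-in : ∀ x → t ≤ g x → χ x ≡ + 1
    χ-in x p with t ℤₚ.≤? g x
    ... | yes _ = refl
    ... | no ¬p = contradiction p ¬p
    χ-out : ∀ x → g x < t → χ x ≡ + 0
    χ-out x p with t ℤₚ.≤? g x
    ... | yes q = contradiction q (ℤₚ.<⇒≱ p)
    ... | no _  = refl

    q>0 = ℤₚ.≰⇒> q≰0
    inside  = χ-in (r e₀) ℤₚ.≤-refl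
    outside = χ-out (r (i e₀)) (slope>0⇒< e₀ h₀ q>0)

    T-e₀ : T e₀ ≡ q e₀
    T-e₀ with i e₀ ≟ e₀
    ... | yes p = contradiction p h₀
    ... | no _  = trans (cong₂ (λ a b → (a - b) * q e₀) inside outside) (ℤₚ.*-identityˡ (q e₀))
    T-ie₀ : T (i e₀) ≡ q e₀
    T-ie₀ with i (i e₀) ≟ i e₀
    ... | yes p = contradiction p (halfEdge-i h₀)
    ... | no _  = trans (cong₂ (λ a b → (a - b) * q (i e₀)) outside (trans (cong (χ ∘ r) (i-invol e₀)) inside))
        (trans (ℤₚ.-1*i≡-i (q (i e₀))) (trans (cong -_ (anti e₀ h₀)) (ℤₚ.neg-involutive (q e₀))))

    -- Inside the level set effectiveness of `D` gives the bound `D + Lap`, outside it effectiveness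
    -- of `D + Lap` does. That divisor has the same degree as `D`, since a Laplacian has degree 0.
    flow≤ : sumℤ (λ x → χ x * Lap G q x) ≤ sumℤ D
    flow≤ = subst (sumℤ (λ x → χ x * Lap G q x) ≤_)
      (trans (sumℤ-+ D (Lap G q)) (trans (cong (λ t → sumℤ D + t) (deg-lap q anti)) (ℤₚ.+-identityʳ (sumℤ D))))
      (sumℤ-mono le)
      where
      le : ∀ x → χ x * Lap G q x ≤ D x + Lap G q x
      le x with t ℤₚ.≤? g x
      ... | yes _ = subst₂ _≤_ (trans (ℤₚ.+-identityˡ _) (sym (ℤₚ.*-identityˡ (Lap G q x)))) refl
                      (ℤₚ.+-monoˡ-≤ (Lap G q x) (D≥0 x))
      ... | no _  = subst (_≤ D x + Lap G q x) (sym (ℤₚ.*-zeroˡ (Lap G q x))) (E≥0 x)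

    halve : ∀ {a b} → a + a ≤ b + b → a ≤ b
    halve {a} {b} le = ℤₚ.≮⇒≥ λ b<a → ℤₚ.<⇒≱ (ℤₚ.+-mono-< b<a b<a) le

-- Subdividing an edge

pattern w₀ = zero
pattern a₁ = suc zero
pattern b₂ = suc (suc zero)
pattern ↑_ x = suc (suc (suc x))

Reach-trans : ∀ {n} {r i : Fin n → Fin n} {u v w} → Reach r i u v → Reach r i v w → Reach r i u w
Reach-trans p here     = p
Reach-trans p (step q) = step (Reach-trans p q)

Reach-edge : ∀ {n} {r i : Fin n → Fin n} {u v w} e → r e ≡ v → r (i e) ≡ w → Reach r i u v → Reach r i u w
Reach-edge e refl refl p = step p

module Subdivide {n} (G : Graph n) (e : Fin n) (he : Graph.i G e ≢ e) where
  open Graph G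

  R I : Fin (suc (suc (suc n))) → Fin (suc (suc (suc n)))
  R = subR G e
  I = subI G e

  ↑-injective : {x y : Fin n} → _≡_ {A = Fin (suc (suc (suc n)))} (↑ x) (↑ y) → x ≡ y
  ↑-injective refl = refl

  I-e : I (↑ e) ≡ a₁
  I-e with e ≟ e
  ... | yes _ = refl
  ... | no ¬p = contradiction refl ¬p

  I-ie : I (↑ i e) ≡ b₂
  I-ie with i e ≟ e | i e ≟ i e
  ... | yes p | _     = contradiction p he
  ... | no _  | yes _ = refl
  ... | no _  | no ¬p = contradiction refl ¬p

  I-other : ∀ x → x ≢ e → x ≢ i e → I (↑ x) ≡ ↑ i x
  I-other x p q with x ≟ e | x ≟ i e
  ... | yes p′ | _      = contradiction p′ p
  ... | no _   | yes q′ = contradiction q′ q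
  ... | no _   | no _   = refl

  data View : Fin n → Set where
    at-e  : View e
    at-ie : View (i e)
    other : ∀ {x} → x ≢ e → x ≢ i e → View x

  view : ∀ x → View x
  view x with x ≟ e | x ≟ i e
  ... | yes refl | _        = at-e
  ... | no _     | yes refl = at-ie
  ... | no p     | no q     = other p q

  i-other : ∀ {x} → x ≢ e → x ≢ i e → (i x ≢ e) × (i x ≢ i e)
  i-other {x} p q = (λ eq → q (trans (sym (i-invol x)) (cong i eq)))
                  , (λ eq → p (trans (sym (i-invol x)) (trans (cong i eq) (i-invol e))))

  I-fixed⇒ : ∀ x → I (↑ x) ≡ ↑ x → i x ≡ x
  I-fixed⇒ x eq with view x
  ... | at-e      = contradiction (trans (sym I-e) eq) λ ()
  ... | at-ie     = contradiction (trans (sym I-ie) eq) λ ()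
  ... | other p q = ↑-injective (trans (sym (I-other x p q)) eq)

  I-fixed⇐ : ∀ x → i x ≡ x → I (↑ x) ≡ ↑ x
  I-fixed⇐ x eq with view x
  ... | at-e      = contradiction eq he
  ... | at-ie     = contradiction eq (halfEdge-i G he)
  ... | other p q = trans (I-other x p q) (cong ↑_ eq)

  R-idem : ∀ x → R (R x) ≡ R x
  R-idem w₀    = refl
  R-idem a₁    = refl
  R-idem b₂    = refl
  R-idem (↑ x) = cong ↑_ (r-idem x)

  I-invol : ∀ x → I (I x) ≡ x
  I-invol w₀ = refl
  I-invol a₁ = I-e
  I-invol b₂ = I-ie
  I-invol (↑ x) with view x
  ... | at-e      = cong I I-e
  ... | at-ie     = cong I I-ie
  ... | other p q = trans (cong I (I-other x p q))
                      (trans (I-other (i x) (proj₁ (i-other p q)) (proj₂ (i-other p q))) (cong ↑_ (i-invol x)))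

  fix-I⇒R : ∀ x → I x ≡ x → R x ≡ x
  fix-I⇒R w₀    _  = refl
  fix-I⇒R a₁    ()
  fix-I⇒R b₂    ()
  fix-I⇒R (↑ x) eq = cong ↑_ (fix-i⇒r x (I-fixed⇒ x eq))

  fix-R⇒I : ∀ x → R x ≡ x → I x ≡ x
  fix-R⇒I w₀    _  = refl
  fix-R⇒I a₁    ()
  fix-R⇒I b₂    ()
  fix-R⇒I (↑ x) eq = I-fixed⇐ x (fix-r⇒i x (↑-injective eq))

  lift-reach : ∀ {u v} → Reach r i u v → Reach R I (↑ u) (↑ v)
  lift-reach here = here
  lift-reach (step {x} p) with view x
  ... | at-e      = Reach-edge b₂ refl refl (Reach-edge (↑ e) refl (cong R I-e) (lift-reach p))
  ... | at-ie     = Reach-edge a₁ refl (cong (↑_ ∘ r) (sym (i-invol e)))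
                      (Reach-edge (↑ i e) refl (cong R I-ie) (lift-reach p))
  ... | other p′ q′ = Reach-edge (↑ x) refl (cong R (I-other x p′ q′)) (lift-reach p)

  K-connected : ∀ u v → I u ≡ u → I v ≡ v → Reach R I u v
  K-connected w₀    w₀    _ _ = here
  K-connected w₀    (↑ v) _ q = Reach-trans (Reach-edge a₁ refl refl here)
    (lift-reach (connected (r e) v (r-vertex G e) (I-fixed⇒ v q)))
  K-connected (↑ u) w₀    p _ = Reach-edge (↑ e) refl (cong R I-e)
    (lift-reach (connected u (r e) (I-fixed⇒ u p) (r-vertex G e)))
  K-connected (↑ u) (↑ v) p q = lift-reach (connected u v (I-fixed⇒ u p) (I-fixed⇒ v q))
  K-connected a₁ _  () _
  K-connected b₂ _  () _
  K-connected w₀    a₁ _ ()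
  K-connected w₀    b₂ _ ()
  K-connected (↑ _) a₁ _ ()
  K-connected (↑ _) b₂ _ ()

  K : Graph (suc (suc (suc n)))
  K = record
    { r = R ; i = I ; r-idem = R-idem ; i-invol = I-invol ; fix-i⇒r = fix-I⇒R ; fix-r⇒i = fix-R⇒I
    ; hasVertex = w₀ , refl ; connected = K-connected }

  K-step : SubdivStep G K
  K-step = e , he , (λ _ → refl) , (λ _ → refl)

  extend : ∀ {ℓ} {A : Set ℓ} → A → A → A → (Fin n → A) → Fin (suc (suc (suc n))) → A
  extend w a b f w₀    = w
  extend w a b f a₁    = a
  extend w a b f b₂    = b
  extend w a b f (↑ x) = f x

  lap-new : ∀ q → Lap K q w₀ ≡ q a₁ + q b₂
  lap-new q = trans (ℤₚ.+-identityˡ _) (cong (λ t → q a₁ + t)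
    (trans (cong (λ t → q b₂ + t) (sumℤ-0 {n} λ _ → refl)) (ℤₚ.+-identityʳ (q b₂))))

  lap-half : ∀ q → (Lap K q a₁ ≡ + 0) × (Lap K q b₂ ≡ + 0)
  lap-half q = lap-nonvertex K q a₁ (λ ()) , lap-nonvertex K q b₂ (λ ())

  lap-old : ∀ q x → Lap K q (↑ x) ≡ Lap G (λ y → q (↑ y)) x
  lap-old q x = trans (ℤₚ.+-identityˡ _) (trans (ℤₚ.+-identityˡ _) (trans (ℤₚ.+-identityˡ _) (sumℤ-cong term)))
    where
    term : ∀ y → (if does (r y ≟ x) ∧ not (does (I (↑ y) ≟ ↑ y)) then q (↑ y) else + 0)
               ≡ (if does (r y ≟ x) ∧ not (does (i y ≟ y)) then q (↑ y) else + 0)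
    term y with I (↑ y) ≟ ↑ y | i y ≟ y
    ... | yes _ | yes _ = refl
    ... | no _  | no _  = refl
    ... | yes p | no ¬p = contradiction (I-fixed⇒ y p) ¬p
    ... | no ¬p | yes p = contradiction (I-fixed⇐ y p) ¬p

  module _ (L : Lengths G) where
    open Lengths L

    -- Each cut splits off one unit next to `r e`. The half-edges `e` and `a₁` form the segment of
    -- length 1, while `b₂` and `i e` form the rest.
    oldLen : Fin n → ℕ
    oldLen x = if does (x ≟ e) then 1 else if does (x ≟ i e) then len e ∸ 1 else len x

    newLen : Fin (suc (suc (suc n))) → ℕ
    newLen = extend 0 1 (len e ∸ 1) oldLen

    oldLen-e : oldLen e ≡ 1
    oldLen-e with e ≟ e
    ... | yes _ = refl
    ... | no ¬p = contradiction refl ¬p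

    oldLen-ie : oldLen (i e) ≡ len e ∸ 1
    oldLen-ie with i e ≟ e | i e ≟ i e
    ... | yes p | _     = contradiction p he
    ... | no _  | yes _ = refl
    ... | no _  | no ¬p = contradiction refl ¬p

    oldLen-other : ∀ x → x ≢ e → x ≢ i e → oldLen x ≡ len x
    oldLen-other x p q with x ≟ e | x ≟ i e
    ... | yes p′ | _      = contradiction p′ p
    ... | no _   | yes q′ = contradiction q′ q
    ... | no _   | no _   = refl

    newLengths : 2 ℕ.≤ len e → Lengths K
    newLengths 2≤ = record { len = newLen ; len>0 = pos ; len-sym = symm }
      where
      0<len-1 : 0 ℕ.< len e ∸ 1
      0<len-1 = ℕₚ.m<n⇒0<n∸m 2≤
      pos : ∀ x → I x ≢ x → 0 ℕ.< newLen x
      pos w₀ h = contradiction refl h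
      pos a₁ h = ℕ.s≤s ℕ.z≤n
      pos b₂ h = 0<len-1
      pos (↑ x) h with view x
      ... | at-e      = subst (0 ℕ.<_) (sym oldLen-e) (ℕ.s≤s ℕ.z≤n)
      ... | at-ie     = subst (0 ℕ.<_) (sym oldLen-ie) 0<len-1
      ... | other p q = subst (0 ℕ.<_) (sym (oldLen-other x p q)) (len>0 x (h ∘ I-fixed⇐ x))
      symm : ∀ x → I x ≢ x → newLen (I x) ≡ newLen x
      symm w₀ h = refl
      symm a₁ h = oldLen-e
      symm b₂ h = oldLen-ie
      symm (↑ x) h with view x
      ... | at-e      = trans (cong newLen I-e) (sym oldLen-e)
      ... | at-ie     = trans (cong newLen I-ie) (sym oldLen-ie)
      ... | other p q = trans (cong newLen (I-other x p q))
            (trans (oldLen-other (i x) (proj₁ (i-other p q)) (proj₂ (i-other p q)))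
              (trans (len-sym x (h ∘ I-fixed⇐ x)) (sym (oldLen-other x p q))))

    -- `a₁` points back along `e`, hence the sign; `b₂` continues in the direction of `e`. With
    -- these opposite slopes the Laplacian vanishes at the new vertex.
    newSlope : (Fin n → ℤ) → Fin (suc (suc (suc n))) → ℤ
    newSlope q = extend (+ 0) (- q e) (q e) q

    -- The value at the new vertex is the linear interpolation one unit away from `r e`. The two
    -- zeros are defaults at half-edges.
    newValue : (Fin n → ℤ) → (Fin n → ℤ) → Fin (suc (suc (suc n))) → ℤ
    newValue g q = extend (g (r e) - q e) (+ 0) (+ 0) g

    interpolate : 2 ℕ.≤ len e → ∀ {g q} → IsPL G len g q → IsPL K newLen (newValue g q) (newSlope q)
    interpolate 2≤ {g} {q} pl = new
      where
      anti : q (i e) ≡ - q e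
      anti = slope-antisym G L {g} {q} pl e he
      len≡ : + len e ≡ + 1 + + (len e ∸ 1)
      len≡ = cong +_ (sym (ℕₚ.m+[n∸m]≡n (ℕₚ.<⇒≤ 2≤)))
      drop : ∀ a q → a - (a - q) ≡ q * + 1
      drop = ℤ-Ring.solve-∀
      gain : ∀ a q → (a - q) - a ≡ - q * + 1
      gain = ℤ-Ring.solve-∀
      rest : ∀ a b q m → a - b ≡ q * (+ 1 + m) → (a - q) - b ≡ q * m
      rest a b q m eq = trans (shift a b q) (trans (cong (_- q) eq) (cut q m))
        where
        shift : ∀ a b q → (a - q) - b ≡ (a - b) - q
        shift = ℤ-Ring.solve-∀
        cut : ∀ q m → q * (+ 1 + m) - q ≡ q * m
        cut = ℤ-Ring.solve-∀
      far : (g (r e) - q e) - g (r (i e)) ≡ q e * + (len e ∸ 1)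
      far = rest (g (r e)) (g (r (i e))) (q e) (+ (len e ∸ 1)) (trans (pl e he) (cong (λ t → q e * t) len≡))
      flip : ∀ a b → a - b ≡ - (b - a)
      flip = ℤ-Ring.solve-∀
      new : IsPL K newLen (newValue g q) (newSlope q)
      new w₀ h = contradiction refl h
      new a₁ h = gain (g (r e)) (q e)
      new b₂ h = far
      new (↑ x) h with view x
      ... | at-e = trans (cong (λ y → g (r e) - newValue g q (R y)) I-e)
              (trans (drop (g (r e)) (q e)) (cong (λ t → q e * + t) (sym oldLen-e)))
      ... | at-ie = trans (cong (λ y → g (r (i e)) - newValue g q (R y)) I-ie)
              (trans (flip (g (r (i e))) (g (r e) - q e)) (trans (cong -_ far)
                (trans (ℤₚ.neg-distribˡ-* (q e) (+ (len e ∸ 1)))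
                  (cong₂ (λ s t → s * + t) (sym anti) (sym oldLen-ie)))))
      ... | other p p′ = trans (cong (λ y → g (r x) - newValue g q (R y)) (I-other x p p′))
              (trans (pl x (h ∘ I-fixed⇐ x)) (cong (λ t → q x * + t) (sym (oldLen-other x p p′))))

  newDivisor : (Fin n → ℤ) → Fin (suc (suc (suc n))) → ℤ
  newDivisor = extend (+ 0) (+ 0) (+ 0)

-- Covering divisors

record Move {n} (G : Graph n) (len : Fin n → ℕ) (D : Fin n → ℤ) : Set where
  field
    value slope : Fin n → ℤ
    pl          : IsPL G len value slope
    effective   : ∀ x → + 0 ≤ D x + Lap G slope x

open Move

module _ {n} (G : Graph n) (len : Fin n → ℕ) (D : Fin n → ℤ) where
  open Graph G

  Reaches : Fin n → Set
  Reaches w = Σ (Move G len D) λ m → + 1 ≤ D w + Lap G (slope m) w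

  -- Once all lengths are 1, truncating such a move at its value at w puts a chip on w.
  Passes : Fin n → Set
  Passes w = Σ (Move G len D) λ m → ∃[ b ] (r b ≡ w × i b ≢ b × + 0 < slope m b)

-- The invariant of repeated subdivision. A truncated function may bend in the interior of an edge
-- longer than 1, so at a new vertex truncation is postponed and `covered` records only a function
-- with positive slope there. `sloped` supplies such a function for every edge that may still be
-- cut.
record Covering {n} (G : Graph n) : Set where
  open Graph G
  field
    lengths   : Lengths G
    D         : Fin n → ℤ
    divisor   : IsDivisor ℕ+ G D
    D≥0       : ∀ x → + 0 ≤ D x
  open Lengths lengths public
  field
    covered   : ∀ w → i w ≡ w → Reaches G len D w ⊎ Passes G len D w
    sloped    : ∀ e → i e ≢ e → len e ≡ 1 ⊎ Σ (Move G len D) λ m → slope m e ≢ + 0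

module _ {n} (G : Graph n) (C : Covering G) (e : Fin n) (he : Graph.i G e ≢ e) (2≤ : 2 ℕ.≤ Covering.len C e) where
  open Graph G
  open Covering C
  open Subdivide G e he

  newMove : Move G len D → Move K (newLen lengths) (newDivisor D)
  newMove m = record
    { value = newValue lengths (value m) (slope m) ; slope = q′
    ; pl = interpolate lengths 2≤ {value m} {slope m} (pl m) ; effective = eff }
    where
    q′ = newSlope lengths (slope m)
    eff : ∀ x → + 0 ≤ newDivisor D x + Lap K q′ x
    eff w₀    = ℤₚ.≤-reflexive (sym (trans (ℤₚ.+-identityˡ _) (trans (lap-new q′) (ℤₚ.+-inverseˡ (slope m e)))))
    eff a₁    = ℤₚ.≤-reflexive (sym (trans (ℤₚ.+-identityˡ _) (proj₁ (lap-half q′))))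
    eff b₂    = ℤₚ.≤-reflexive (sym (trans (ℤₚ.+-identityˡ _) (proj₂ (lap-half q′))))
    eff (↑ x) = subst (λ t → + 0 ≤ D x + t) (sym (lap-old q′ x)) (effective m x)

  steepMove : Σ (Move G len D) λ m → slope m e ≢ + 0
  steepMove with sloped e he
  ... | inj₁ one = contradiction (subst (2 ℕ.≤_) one 2≤) λ { (ℕ.s≤s ()) }
  ... | inj₂ m   = m

  subdivideCovering : Covering K
  subdivideCovering = record
    { lengths = newLengths lengths 2≤ ; D = newDivisor D ; divisor = div ; D≥0 = pos
    ; covered = cov ; sloped = slo }
    where
    div : IsDivisor ℕ+ K (newDivisor D)
    div w₀    h = refl
    div a₁    h = refl
    div b₂    h = refl
    div (↑ x) h = divisor x (h ∘ I-fixed⇐ x)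
    pos : ∀ x → + 0 ≤ newDivisor D x
    pos w₀    = ℤₚ.≤-refl
    pos a₁    = ℤₚ.≤-refl
    pos b₂    = ℤₚ.≤-refl
    pos (↑ x) = D≥0 x
    m₀ = newMove (proj₁ steepMove)
    steep-neg : - slope (proj₁ steepMove) e ≢ + 0
    steep-neg eq = proj₂ steepMove (trans (sym (ℤₚ.neg-involutive _)) (cong -_ eq))
    cov : ∀ w → I w ≡ w → Reaches K (newLen lengths) (newDivisor D) w ⊎ Passes K (newLen lengths) (newDivisor D) w
    -- The chosen function is not constant along the cut edge, so exactly one of the two half-edges
    -- at `w₀` has positive slope; the sign decides which.
    cov w₀ _ = inj₂ (passes (ℤₚ.≤-total (+ 0) (slope (proj₁ steepMove) e)))
      where
      passes : + 0 ≤ slope (proj₁ steepMove) e ⊎ slope (proj₁ steepMove) e ≤ + 0 → Passes K (newLen lengths) (newDivisor D) w₀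
      passes (inj₁ le) = m₀ , b₂ , refl , (λ ()) , ℤₚ.≤∧≢⇒< le (proj₂ steepMove ∘ sym)
      passes (inj₂ le) = m₀ , a₁ , refl , (λ ()) , ℤₚ.≤∧≢⇒< (ℤₚ.neg-mono-≤ le) (steep-neg ∘ sym)
    cov a₁ ()
    cov b₂ ()
    cov (↑ x) p with covered x (I-fixed⇒ x p)
    ... | inj₁ (m , le) = inj₁ (newMove m , subst (λ t → + 1 ≤ D x + t) (sym (lap-old (slope (newMove m)) x)) le)
    ... | inj₂ (m , b , rb , hb , lt) = inj₂ (newMove m , ↑ b , cong ↑_ rb , hb ∘ I-fixed⇒ b , lt)
    slo : ∀ x → I x ≢ x → newLen lengths x ≡ 1 ⊎ Σ (Move K (newLen lengths) (newDivisor D)) λ m → slope m x ≢ + 0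
    slo w₀ h = contradiction refl h
    slo a₁ h = inj₂ (m₀ , steep-neg)
    slo b₂ h = inj₂ (m₀ , proj₂ steepMove)
    slo (↑ x) h with sloped x (h ∘ I-fixed⇐ x)
    ... | inj₂ (m , ne) = inj₂ (newMove m , ne)
    ... | inj₁ one with view x
    ...   | at-e      = inj₁ (oldLen-e lengths)
    ...   | at-ie     = contradiction (subst (2 ℕ.≤_) (trans (sym (len-sym e he)) one) 2≤) λ { (ℕ.s≤s ()) }
    ...   | other p q = inj₁ (trans (oldLen-other lengths x p q) one)

  degree-newDivisor : sumℤ (newDivisor D) ≡ sumℤ D
  degree-newDivisor = trans (ℤₚ.+-identityˡ _) (trans (ℤₚ.+-identityˡ _) (ℤₚ.+-identityˡ _))

-- Termination of repeated subdivision

sumℕ : ∀ {n} → (Fin n → ℕ) → ℕ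
sumℕ {zero}  f = 0
sumℕ {suc n} f = f zero ℕ.+ sumℕ (f ∘ suc)

sumℕ-mono : ∀ {n} {f g : Fin n → ℕ} → (∀ x → f x ℕ.≤ g x) → sumℕ f ℕ.≤ sumℕ g
sumℕ-mono {zero}  le = ℕ.z≤n
sumℕ-mono {suc n} le = ℕₚ.+-mono-≤ (le zero) (sumℕ-mono (le ∘ suc))

sumℕ-drop : ∀ {n} {f g : Fin n → ℕ} (a : Fin n) → f a ≡ 0 → (∀ x → f x ℕ.≤ g x) → g a ℕ.+ sumℕ f ℕ.≤ sumℕ g
sumℕ-drop {suc n} {f} {g} zero    fa le = subst (λ t → g zero ℕ.+ (t ℕ.+ sumℕ (f ∘ suc)) ℕ.≤ sumℕ g) (sym fa)
  (ℕₚ.+-monoʳ-≤ (g zero) (sumℕ-mono (le ∘ suc)))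
sumℕ-drop {suc n} {f} {g} (suc a) fa le = subst (ℕ._≤ sumℕ g) (x∙yz≈y∙xz ℕₚ.+-commutativeSemigroup (f zero) (g (suc a)) _)
  (ℕₚ.+-mono-≤ (le zero) (sumℕ-drop a fa (le ∘ suc)))

excess : ∀ {n} {G : Graph n} → Covering G → ℕ
excess C = sumℕ (λ x → Covering.len C x ∸ 1)

-- The contribution `len e ∸ 1` of `e` drops to 0, and of the new elements only `b₂` can contribute,
-- with `len e ∸ 2`. No other contribution grows.
subdivide-excess : ∀ {n} (G : Graph n) (C : Covering G) e he 2≤ → excess (subdivideCovering G C e he 2≤) ℕ.< excess C
subdivide-excess G C e he 2≤ = begin-strict
  (L ∸ 1) ℕ.+ sumℕ (λ x → oldLen lengths x ∸ 1)
    <⟨ ℕₚ.+-monoˡ-< _ (ℕₚ.∸-monoʳ-< {L} (ℕ.s≤s ℕ.z≤n) (ℕₚ.m<n⇒0<n∸m 2≤)) ⟩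
  L ℕ.+ sumℕ (λ x → oldLen lengths x ∸ 1)
    ≤⟨ sumℕ-drop e (cong (_∸ 1) (oldLen-e lengths)) le ⟩
  excess C ∎
  where
  open ℕₚ.≤-Reasoning
  open Covering C
  open Subdivide G e he
  L = len e ∸ 1
  le : ∀ x → oldLen lengths x ∸ 1 ℕ.≤ len x ∸ 1
  le x with view x
  ... | at-e      = subst (λ t → t ∸ 1 ℕ.≤ L) (sym (oldLen-e lengths)) ℕ.z≤n
  ... | at-ie     = subst₂ (λ s t → s ∸ 1 ℕ.≤ t ∸ 1) (sym (oldLen-ie lengths)) (sym (len-sym e he)) (ℕₚ.m∸n≤m L 1)
  ... | other p q = ℕₚ.≤-reflexive (cong (_∸ 1) (oldLen-other lengths x p q))

UnitCovering : ∀ {m} → Graph m → ℤ → Set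
UnitCovering H d = Σ (Covering H) λ C → (∀ e → Graph.i H e ≢ e → Covering.len C e ≡ 1) × sumℤ (Covering.D C) ≡ d

subdivideFully : ∀ {n₀ n} {G₀ : Graph n₀} {G : Graph n} → Subdivision G₀ G →
  (C : Covering G) → Acc ℕ._<_ (excess C) →
  ∃[ m ] Σ (Graph m) λ H → Subdivision G₀ H × UnitCovering H (sumℤ (Covering.D C))
subdivideFully {G = G} sub C (acc smaller) with any? (λ e → ¬? (Graph.i G e ≟ e) ×-dec (2 ℕ.≤? Covering.len C e))
... | no none = _ , G , sub , C , (λ e h → ℕₚ.≤-antisym (ℕₚ.≮⇒≥ λ 2≤ → none (e , h , 2≤)) (len>0 e h)) , refl
  where open Covering C
... | yes (e , he , 2≤)
  with m , H , sub′ , C′ , unit , deg≡ ← subdivideFully (step sub (Subdivide.K-step G e he))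
         (subdivideCovering G C e he 2≤) (smaller (subdivide-excess G C e he 2≤))
  = m , H , sub′ , C′ , unit , trans deg≡ (degree-newDivisor G C e he 2≤)

-- Truncation

-- min(g , c) as a move: at x with g x ≤ c no slope decreases, and at x with g x ≥ c all slopes are ≥ 0.
module Truncate {n} (G : Graph n) (C : Covering G) (unit : ∀ e → Graph.i G e ≢ e → Covering.len C e ≡ 1)
  (m : Move G (Covering.len C) (Covering.D C)) (w : Fin n) where
  open Graph G
  open Covering C

  c : ℤ
  c = value m w

  g′ q′ : Fin n → ℤ
  g′ x = value m x ℤ.⊓ c
  q′ e = g′ (r e) - g′ (r (i e))

  slope-unit : ∀ e → i e ≢ e → slope m e ≡ value m (r e) - value m (r (i e))
  slope-unit e h = sym (trans (pl m e h) (trans (cong (λ t → slope m e * + t) (unit e h)) (ℤₚ.*-identityʳ _)))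

  q′-below : ∀ e → i e ≢ e → value m (r e) ≤ c → slope m e ≤ q′ e
  q′-below e h le = subst₂ _≤_ (sym (slope-unit e h)) (cong (_- g′ (r (i e))) (sym (ℤₚ.i≤j⇒i⊓j≡i le)))
    (ℤₚ.+-monoʳ-≤ (value m (r e)) (ℤₚ.neg-mono-≤ (ℤₚ.i⊓j≤i (value m (r (i e))) c)))

  q′-above : ∀ e → c ≤ value m (r e) → + 0 ≤ q′ e
  q′-above e le = ℤₚ.i≤j⇒0≤j-i (subst (g′ (r (i e)) ≤_) (sym (ℤₚ.i≥j⇒i⊓j≡j le)) (ℤₚ.i⊓j≤j (value m (r (i e))) c))

  lap-above : ∀ x → c ≤ value m x → + 0 ≤ Lap G q′ x
  lap-above x le = subst (_≤ Lap G q′ x) (lap-0 G x) (lap-mono G x λ { e refl h → q′-above e le })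

  truncated : Move G len D
  truncated = record { value = g′ ; slope = q′ ; pl = pl′ ; effective = eff }
    where
    pl′ : IsPL G len g′ q′
    pl′ e h = sym (trans (cong (λ t → q′ e * + t) (unit e h)) (ℤₚ.*-identityʳ (q′ e)))
    eff : ∀ x → + 0 ≤ D x + Lap G q′ x
    eff x with ℤₚ.≤-total (value m x) c
    ... | inj₁ le = ℤₚ.≤-trans (effective m x) (ℤₚ.+-monoʳ-≤ (D x) (lap-mono G x λ { e refl h → q′-below e h le }))
    ... | inj₂ ge = ℤₚ.+-mono-≤ (D≥0 x) (lap-above x ge)

  -- `w` lies exactly at the truncation level, so both estimates apply there: every new slope at `w`
  -- is nonnegative, and the one along `b` is at least its old positive value.
  truncated-reaches : ∀ b → r b ≡ w → i b ≢ b → + 0 < slope m b → + 1 ≤ D w + Lap G q′ w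
  truncated-reaches b refl h lt = ℤₚ.+-mono-≤ (D≥0 w) (ℤₚ.≤-trans (ℤₚ.i<j⇒suc[i]≤j lt)
    (ℤₚ.≤-trans (q′-below b h ℤₚ.≤-refl) (lap-≥term G w (λ { e re _ → q′-above e (ℤₚ.≤-reflexive (cong (value m) (sym re))) }) b refl h)))

reaches : ∀ {n} (G : Graph n) (C : Covering G) → (∀ e → Graph.i G e ≢ e → Covering.len C e ≡ 1) →
  ∀ w → Graph.i G w ≡ w → Reaches G (Covering.len C) (Covering.D C) w
reaches G C unit w vw with Covering.covered C w vw
... | inj₁ p = p
... | inj₂ (m , b , rb , h , lt) = truncated , truncated-reaches b rb h lt
  where open Truncate G C unit m w

-- From covering divisors to rank

module _ {n} (G : Graph n) where
  open Graph G

  diff : Gp ℕ+ G → ℤ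
  diff (a , b) = + a - + b

  diff-injective : ∀ x y → diff x ≡ diff y → _≈gp_ ℕ+ G x y
  diff-injective (a , b) (a′ , b′) eq = ℤₚ.+-injective (trans (ℤₚ.pos-+ a b′) (trans (sym (add (+ a) (+ b) (+ b′)))
    (trans (cong (λ t → t + (+ b + + b′)) eq) (trans (add′ (+ a′) (+ b′) (+ b)) (sym (ℤₚ.pos-+ a′ b))))))
    where
    add : ∀ a b c → (a - b) + (b + c) ≡ a + c
    add = ℤ-Ring.solve-∀
    add′ : ∀ a c b → (a - c) + (b + c) ≡ a + b
    add′ = ℤ-Ring.solve-∀

  diff-- : ∀ x y → diff (_-gp_ ℕ+ G x y) ≡ diff x - diff y
  diff-- (a , b) (a′ , b′) = trans (cong₂ _-_ (ℤₚ.pos-+ a b′) (ℤₚ.pos-+ b a′)) (arrange (+ a) (+ b) (+ a′) (+ b′))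
    where
    arrange : ∀ a b a′ b′ → (a + b′) - (b + a′) ≡ (a - b) - (a′ - b′)
    arrange = ℤ-Ring.solve-∀

  toGp : ℤ → Gp ℕ+ G
  toGp (+ k)    = k , 0
  toGp -[1+ k ] = 0 , suc k

  diff-toGp : ∀ z → diff (toGp z) ≡ z
  diff-toGp (+ k)    = ℤₚ.+-identityʳ (+ k)
  diff-toGp -[1+ k ] = refl

  times-1 : ∀ k → times ℕ+ G k 1 ≡ k
  times-1 zero    = refl
  times-1 (suc k) = cong suc (times-1 k)

  diff-· : ∀ z → diff (_·gp_ ℕ+ G z 1) ≡ z
  diff-· (+ k)    = trans (cong (λ t → + t - + 0) (times-1 k)) (ℤₚ.+-identityʳ (+ k))
  diff-· -[1+ k ] = cong (λ t → + 0 - + t) (times-1 (suc k))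

  witness : ∀ {g q} → IsPL G (λ _ → 1) g q → PLWitness ℕ+ G (unitLen G) (toGp ∘ g) q
  witness {g} {q} pl e h = subst (λ l → _≈gp_ ℕ+ G (_-gp_ ℕ+ G (toGp (g (r e))) (toGp (g (r (i e))))) (_·gp_ ℕ+ G (q e) l)) (sym unit)
    (diff-injective (_-gp_ ℕ+ G (toGp (g (r e))) (toGp (g (r (i e))))) (_·gp_ ℕ+ G (q e) 1) (trans (diff-- (toGp (g (r e))) (toGp (g (r (i e)))))
      (trans (cong₂ _-_ (diff-toGp (g (r e))) (diff-toGp (g (r (i e)))))
        (trans (pl e h) (trans (ℤₚ.*-identityʳ (q e)) (sym (diff-· (q e))))))))
    where
    unit : unitLen G e ≡ 1
    unit with i e ≟ e
    ... | yes p = contradiction p h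
    ... | no _  = refl

effective-degree-1 : ∀ {n} (F : Fin n → ℤ) → (∀ x → + 0 ≤ F x) → sumℤ F ≡ + 1 →
  ∃[ w ] (F w ≡ + 1 × (∀ x → x ≢ w → F x ≡ + 0))
effective-degree-1 {suc n} F F≥0 eq = split (F zero) refl (F≥0 zero)
  where
  F′ = F ∘ suc
  split : ∀ z → F zero ≡ z → + 0 ≤ z → ∃[ w ] (F w ≡ + 1 × (∀ x → x ≢ w → F x ≡ + 0))
  split (+ zero) F0 _ with effective-degree-1 F′ (F≥0 ∘ suc)
      (trans (sym (ℤₚ.+-identityˡ _)) (trans (cong (λ t → t + sumℤ F′) (sym F0)) eq))
  ... | w , Fw , rest = suc w , Fw , λ { zero _ → F0 ; (suc x) ne → rest x (ne ∘ cong suc) }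
  split (+ suc k) F0 _ = zero , trans F0 (cong (λ t → + suc t) k≡0) , λ { zero ne → contradiction refl ne ; (suc x) _ → vanish x }
    where
    sum≡ : + suc k + sumℤ F′ ≡ + 1
    sum≡ = trans (cong (λ t → t + sumℤ F′) (sym F0)) eq
    S≥0 : + 0 ≤ sumℤ F′
    S≥0 = sumℤ-≥0 (F≥0 ∘ suc)
    k≤0 : ∀ {s} → + 0 ≤ s → + suc k + s ≡ + 1 → k ≡ 0 × s ≡ + 0
    k≤0 {+ s} _ e = ℕₚ.m+n≡0⇒m≡0 k z , cong +_ (ℕₚ.m+n≡0⇒n≡0 k z)
      where z = ℕₚ.suc-injective (ℤₚ.+-injective e)
    k≡0 = proj₁ (k≤0 S≥0 sum≡)
    vanish : ∀ x → F′ x ≡ + 0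
    vanish x = ℤₚ.≤-antisym (subst (F′ x ≤_) (proj₂ (k≤0 S≥0 sum≡)) (sumℤ-≥term x F′ (F≥0 ∘ suc))) (F≥0 (suc x))

unitCovering-rank : ∀ {n} (G : Graph n) (C : Covering G) → (∀ e → Graph.i G e ≢ e → Covering.len C e ≡ 1) →
  RankAtLeast ℕ+ G (unitLen G) (Covering.D C) 1
unitCovering-rank {n} G C unit = 1 , ℕₚ.≤-refl , rank
  where
  open Graph G
  open Covering C
  rank : RankCond ℕ+ G (unitLen G) D 1
  rank F F-div F≥0 degF with effective-degree-1 F F≥0 degF
  ... | w , Fw , F-off = E , E-div , E≥0 , (toGp G ∘ value m) , slope m , witness G {value m} {slope m} pl₁ , λ x → cancel (D x) (F x) (Lap G (slope m) x)
    where
    vw : i w ≡ w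
    vw with i w ≟ w
    ... | yes p = p
    ... | no h  = contradiction (trans (sym (F-div w h)) Fw) λ ()
    move = reaches G C unit w vw
    m = proj₁ move
    E : Fin n → ℤ
    E x = (D x + Lap G (slope m) x) - F x
    pl₁ : IsPL G (λ _ → 1) (value m) (slope m)
    pl₁ e h = trans (pl m e h) (cong (λ t → slope m e * + t) (unit e h))
    E-div : IsDivisor ℕ+ G E
    E-div x h = cong₂ _-_ (cong₂ _+_ (divisor x h) (lap-nonvertex G (slope m) x h)) (F-div x h)
    E≥0 : ∀ x → + 0 ≤ E x
    E≥0 x with x ≟ w
    ... | yes refl = ℤₚ.i≤j⇒0≤j-i (subst (_≤ D w + Lap G (slope m) w) (sym Fw) (proj₂ move))
    ... | no ne    = ℤₚ.i≤j⇒0≤j-i (subst (_≤ D x + Lap G (slope m) x) (sym (F-off x ne)) (effective m x))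
    cancel : ∀ d f l → ((d + l) - f) - (d - f) ≡ l
    cancel = ℤ-Ring.solve-∀

-- Realisability of prescribed slopes

-- a ≤ b and a < b mean that b - a lies in M, respectively in M without 0.
monoidModel : ∀ {c ℓ} (M : CommutativeMonoid c ℓ) → IsSharp M → IsIntegral M → Model M
monoidModel M sharp integral = record
  { Rel        = λ s x y → ∃[ m ] ((s ≡ true → ¬ m ≈ ε) × x ∙ m ≈ y)
  ; Rel-resp   = λ x≈ y≈ (m , p , eq) → m , p , ≈-trans (∙-cong (≈-sym x≈) ≈-refl) (≈-trans eq y≈)
  ; Rel-refl   = ε , (λ ()) , identityʳ _
  ; Rel-∙      = λ {s} {t} (m , p , eq) (m′ , p′ , eq′) →
      m ∙ m′ , nontrivial s t p p′ , ≈-trans (interchange commutativeSemigroup _ _ _ _) (∙-cong eq eq′)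
  ; Rel-cancel = λ x (m , p , eq) → m , p , integral _ _ x
      (≈-trans (comm _ x) (≈-trans (≈-sym (assoc x _ m)) (≈-trans eq (comm x _))))
  ; Rel-irrefl = λ {x} (m , p , eq) → p refl
      (integral m ε x (≈-trans (comm m x) (≈-trans eq (≈-sym (identityˡ x)))))
  }
  where
  open CommutativeMonoid M renaming (refl to ≈-refl; sym to ≈-sym; trans to ≈-trans)
  -- If m and m′ add up to 0, both are invertible, so sharpness makes both of them 0.
  nontrivial : ∀ s t {m m′} → (s ≡ true → ¬ m ≈ ε) → (t ≡ true → ¬ m′ ≈ ε) → s ∨ t ≡ true → ¬ m ∙ m′ ≈ ε
  nontrivial true  t    p p′ _ eq = p refl (sharp _ (_ , eq))
  nontrivial false true p p′ _ eq = p′ refl (sharp _ (_ , ≈-trans (comm _ _) eq))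

posPart negPart : ℤ → ℕ
posPart (+ k)    = k
posPart -[1+ k ] = 0
negPart (+ k)    = 0
negPart -[1+ k ] = suc k

posPart-negPart : ∀ z → + posPart z - + negPart z ≡ z
posPart-negPart (+ k)    = ℤₚ.+-identityʳ (+ k)
posPart-negPart -[1+ k ] = refl

module System {n} (G : Graph n) where
  open Graph G

  k : ℕ
  k = 3 ℕ.* (n ℕ.* n)

  -- The unknowns are l e and, for each v, a formal difference of functions gp v - gm v.
  index : Fin 3 → Fin n → Fin n → Fin k
  index t v x = combine t (combine v x)

  l# : Fin n → Fin k
  l# e = index zero e e

  gp# gm# : Fin n → Fin n → Fin k
  gp# = index (suc zero)
  gm# = index (suc (suc zero))

  unindex : Fin k → Fin 3 × Fin n × Fin n
  unindex j = proj₁ (remQuot {3} (n ℕ.* n) j) , remQuot {n} n (proj₂ (remQuot {3} (n ℕ.* n) j))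

  unindex-index : ∀ t v x → unindex (index t v x) ≡ (t , v , x)
  unindex-index t v x = trans
    (cong (λ p → proj₁ p , remQuot {n} n (proj₂ p)) (remQuot-combine {3} t (combine v x)))
    (cong (t ,_) (remQuot-combine {n} {n} v x))

  module _ {a} {A : Set a} (l : Fin n → A) (gp gm : Fin n → Fin n → A) where

    choose : Fin 3 × Fin n × Fin n → A
    choose (zero , v , x)           = l x
    choose (suc zero , v , x)       = gp v x
    choose (suc (suc zero) , v , x) = gm v x

    unknowns : Fin k → A
    unknowns = choose ∘ unindex

    unknowns-l : ∀ e → unknowns (l# e) ≡ l e
    unknowns-l e = cong choose (unindex-index zero e e)

    unknowns-gp : ∀ v x → unknowns (gp# v x) ≡ gp v x
    unknowns-gp v x = cong choose (unindex-index (suc zero) v x)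

    unknowns-gm : ∀ v x → unknowns (gm# v x) ≡ gm v x
    unknowns-gm v x = cong choose (unindex-index (suc (suc zero)) v x)

  δ : Fin k → Fin k → ℕ
  δ a j = if does (a ≟ j) then 1 else 0

  -- The factors 1 give the combination the shape that `eval-linear` expects, so two applications of
  -- it suffice for `eval-lin`.
  lin : Fin k → Fin k → ℕ → Fin k → Fin k → ℕ
  lin a b p c j = 1 ℕ.* (1 ℕ.* δ a j ℕ.+ 1 ℕ.* δ b j) ℕ.+ p ℕ.* δ c j

  module _ (q : Fin n → Fin n → ℤ) where

    -- The two sides of "difference of the values at the ends = slope times length", with every
    -- negative term moved to the opposite side. This makes the equation meaningful in `M` itself
    -- rather than in its groupification.
    lhsCoef rhsCoef : Fin n → Fin n → Fin k → ℕ
    lhsCoef v e = lin (gp# v (r e)) (gm# v (r (i e))) (negPart (q v e)) (l# e)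
    rhsCoef v e = lin (gm# v (r e)) (gp# v (r (i e))) (posPart (q v e)) (l# e)

    -- An equation is expressed by two opposite weak constraints; strictness enters through the
    -- positivity of lengths.
    edgeConstraints : Fin n → Fin n → List (Con k)
    edgeConstraints v e =
        con true (λ _ → 0) (δ (l# e))
      ∷ con false (δ (l# (i e))) (δ (l# e))
      ∷ con false (δ (l# e)) (δ (l# (i e)))
      ∷ con false (lhsCoef v e) (rhsCoef v e)
      ∷ con false (rhsCoef v e) (lhsCoef v e)
      ∷ []

    constraintsAt : Fin n → Fin n → List (Con k)
    constraintsAt v e = if does (i e ≟ e) then [] else edgeConstraints v e

    system : List (Con k)
    system = concat (cartesianProductWith constraintsAt (allFin n) (allFin n))

    system⁺ : ∀ {c} v e → i e ≢ e → c ∈ edgeConstraints v e → c ∈ system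
    system⁺ {c} v e h m = ∈-concat⁺′ (member m) (∈-cartesianProductWith⁺ constraintsAt (∈-allFin v) (∈-allFin e))
      where
      member : c ∈ edgeConstraints v e → c ∈ constraintsAt v e
      member m with i e ≟ e
      ... | yes p = contradiction p h
      ... | no _  = m

    system⁻ : ∀ {c} → c ∈ system → ∃[ v ] ∃[ e ] (i e ≢ e × c ∈ edgeConstraints v e)
    system⁻ {c} m with ∈-concat⁻′ (cartesianProductWith constraintsAt (allFin n) (allFin n)) m
    ... | xs , c∈xs , xs∈ with ∈-cartesianProductWith⁻ constraintsAt (allFin n) (allFin n) xs∈
    ...   | v , e , _ , _ , refl = v , e , member c∈xs
      where
      member : c ∈ constraintsAt v e → i e ≢ e × c ∈ edgeConstraints v e
      member m with i e ≟ e
      ... | no h = h , m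

    module _ {c ℓ} {A : CommutativeMonoid c ℓ} (mod : Model A) where
      open CommutativeMonoid A renaming (refl to ≈-refl; sym to ≈-sym; trans to ≈-trans)
      open Model mod
      open Linear mod

      eval-0 : ∀ {k} (x : Fin k → Carrier) → eval (λ _ → 0) x ≈ ε
      eval-0 {zero}  x = ≈-refl
      eval-0 {suc k} x = ≈-trans (identityˡ _) (eval-0 (x ∘ suc))

      eval-δ : ∀ {k} (a : Fin k) (x : Fin k → Carrier) → eval (λ j → if does (a ≟ j) then 1 else 0) x ≈ x a
      eval-δ zero    x = ≈-trans (∙-cong (identityʳ _) (eval-0 (x ∘ suc))) (identityʳ _)
      eval-δ (suc a) x = ≈-trans (identityˡ _) (eval-δ a (x ∘ suc))

      eval-lin : ∀ a b p c (x : Fin k → Carrier) → eval (lin a b p c) x ≈ (x a ∙ x b) ∙ p ⊗ x c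
      eval-lin a b p c x = ≈-trans (eval-linear 1 p (λ j → 1 ℕ.* δ a j ℕ.+ 1 ℕ.* δ b j) (δ c) x)
        (∙-cong (≈-trans (identityʳ _) (≈-trans (eval-linear 1 1 (δ a) (δ b) x)
                  (∙-cong (≈-trans (identityʳ _) (eval-δ a x)) (≈-trans (identityʳ _) (eval-δ b x)))))
                (×-congʳ p (eval-δ c x)))

      eval-lhs : ∀ x v e → eval (lhsCoef v e) x ≈ (x (gp# v (r e)) ∙ x (gm# v (r (i e)))) ∙ negPart (q v e) ⊗ x (l# e)
      eval-lhs x v e = eval-lin (gp# v (r e)) (gm# v (r (i e))) (negPart (q v e)) (l# e) x

      eval-rhs : ∀ x v e → eval (rhsCoef v e) x ≈ (x (gm# v (r e)) ∙ x (gp# v (r (i e)))) ∙ posPart (q v e) ⊗ x (l# e)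
      eval-rhs x v e = eval-lin (gm# v (r e)) (gp# v (r (i e))) (posPart (q v e)) (l# e) x

      lhsVal rhsVal : (Fin k → Carrier) → Fin n → Fin n → Carrier
      lhsVal x v e = (x (gp# v (r e)) ∙ x (gm# v (r (i e)))) ∙ negPart (q v e) ⊗ x (l# e)
      rhsVal x v e = (x (gm# v (r e)) ∙ x (gp# v (r (i e)))) ∙ posPart (q v e) ⊗ x (l# e)

      record Realises (x : Fin k → Carrier) (v e : Fin n) : Set (c ⊔ ℓ) where
        field
          l>0    : Rel true ε (x (l# e))
          l-sym₁ : Rel false (x (l# (i e))) (x (l# e))
          l-sym₂ : Rel false (x (l# e)) (x (l# (i e)))
          pl₁    : Rel false (lhsVal x v e) (rhsVal x v e)
          pl₂    : Rel false (rhsVal x v e) (lhsVal x v e)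

      solves⇒realises : ∀ x → Solves system x → ∀ v e → i e ≢ e → Realises x v e
      solves⇒realises x sol v e h = record
        { l>0    = Rel-resp (eval-0 x) (eval-δ (l# e) x) (sol (system⁺ v e h (here refl)))
        ; l-sym₁ = Rel-resp (eval-δ (l# (i e)) x) (eval-δ (l# e) x) (sol (system⁺ v e h (there (here refl))))
        ; l-sym₂ = Rel-resp (eval-δ (l# e) x) (eval-δ (l# (i e)) x) (sol (system⁺ v e h (there (there (here refl)))))
        ; pl₁    = Rel-resp (eval-lhs x v e) (eval-rhs x v e) (sol (system⁺ v e h (there (there (there (here refl))))))
        ; pl₂    = Rel-resp (eval-rhs x v e) (eval-lhs x v e) (sol (system⁺ v e h (there (there (there (there (here refl)))))))
        }

      realises⇒solves : ∀ x → (∀ v e → i e ≢ e → Realises x v e) → Solves system x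
      realises⇒solves x real m with system⁻ m
      ... | v , e , h , m′ = check m′
        where
        open Realises (real v e h)
        check : ∀ {c} → c ∈ edgeConstraints v e → Sat c x
        check (here refl) = Rel-resp (≈-sym (eval-0 x)) (≈-sym (eval-δ (l# e) x)) l>0
        check (there (here refl)) = Rel-resp (≈-sym (eval-δ (l# (i e)) x)) (≈-sym (eval-δ (l# e) x)) l-sym₁
        check (there (there (here refl))) = Rel-resp (≈-sym (eval-δ (l# e) x)) (≈-sym (eval-δ (l# (i e)) x)) l-sym₂
        check (there (there (there (here refl)))) = Rel-resp (≈-sym (eval-lhs x v e)) (≈-sym (eval-rhs x v e)) pl₁
        check (there (there (there (there (here refl))))) = Rel-resp (≈-sym (eval-rhs x v e)) (≈-sym (eval-lhs x v e)) pl₂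

      Rel-reflexive : ∀ {x y} → x ≈ y → Rel false x y
      Rel-reflexive eq = Rel-resp ≈-refl eq Rel-refl

      module _ (l : Fin n → Carrier) (gp gm : Fin n → Fin n → Carrier)
        (l>0 : ∀ e → i e ≢ e → Rel true ε (l e))
        (l-sym : ∀ e → i e ≢ e → l (i e) ≈ l e)
        (pl : ∀ v e → i e ≢ e → (gp v (r e) ∙ gm v (r (i e))) ∙ negPart (q v e) ⊗ l e
                              ≈ (gm v (r e) ∙ gp v (r (i e))) ∙ posPart (q v e) ⊗ l e) where

        system-solved : Solves system (unknowns l gp gm)
        system-solved = realises⇒solves x λ v e h → record
          { l>0    = Rel-resp ≈-refl (≈-sym (reflexive (ul e))) (l>0 e h)
          ; l-sym₁ = Rel-reflexive (l-sym′ e h)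
          ; l-sym₂ = Rel-reflexive (≈-sym (l-sym′ e h))
          ; pl₁    = Rel-reflexive (pl′ v e h)
          ; pl₂    = Rel-reflexive (≈-sym (pl′ v e h))
          }
          where
          x = unknowns l gp gm
          ul = unknowns-l l gp gm
          up = unknowns-gp l gp gm
          um = unknowns-gm l gp gm
          l-sym′ : ∀ e → i e ≢ e → x (l# (i e)) ≈ x (l# e)
          l-sym′ e h = ≈-trans (reflexive (ul (i e))) (≈-trans (l-sym e h) (≈-sym (reflexive (ul e))))
          pl′ : ∀ v e → i e ≢ e → lhsVal x v e ≈ rhsVal x v e
          pl′ v e h rewrite ul e | up v (r e) | um v (r e) | up v (r (i e)) | um v (r (i e)) = pl v e h

    Realisation : Set
    Realisation = Σ (Lengths G) λ L → Σ (Fin n → Fin n → ℤ) λ g → ∀ v → IsPL G (Lengths.len L) (g v) (q v)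

    solution⇒realisation : ∃ (Linear.Solves ℤ-model system) → Realisation
    solution⇒realisation (x , sol) = L , g , isPL
      where
      real = solves⇒realises ℤ-model x sol
      open ≡-Reasoning
      antisym : ∀ {a b} → + 0 ≤ b - a → + 0 ≤ a - b → a ≡ b
      antisym p p′ = ℤₚ.≤-antisym (ℤₚ.0≤i-j⇒j≤i p) (ℤₚ.0≤i-j⇒j≤i p′)
      positive : ∀ e → i e ≢ e → + 0 < x (l# e)
      positive e h = subst (+ 0 <_) (ℤₚ.+-identityʳ _) (Realises.l>0 (real e e h))
      L : Lengths G
      L = record
        { len     = λ e → ∣ x (l# e) ∣
        ; len>0   = λ e h → ℤₚ.drop‿+<+ (subst (+ 0 <_) (sym (ℤₚ.0≤i⇒+∣i∣≡i (ℤₚ.<⇒≤ (positive e h)))) (positive e h))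
        ; len-sym = λ e h → cong ∣_∣ (antisym {x (l# (i e))} {x (l# e)} (Realises.l-sym₁ (real e e h)) (Realises.l-sym₂ (real e e h)))
        }
      g : Fin n → Fin n → ℤ
      g v y = x (gp# v y) - x (gm# v y)
      isPL : ∀ v → IsPL G (Lengths.len L) (g v) (q v)
      isPL v e h = begin
        (a - b) - (a′ - b′)         ≡⟨ expand a b a′ b′ (+ negPart z * l) ⟩
        ((a + b′) + + negPart z * l) - (b + a′) - + negPart z * l
          ≡⟨ cong (λ t → t - (b + a′) - + negPart z * l) balance ⟩
        ((b + a′) + + posPart z * l) - (b + a′) - + negPart z * l
          ≡⟨ contract (b + a′) (+ posPart z) (+ negPart z) l ⟩
        (+ posPart z - + negPart z) * l
          ≡⟨ cong₂ _*_ (posPart-negPart z) (sym (ℤₚ.0≤i⇒+∣i∣≡i (ℤₚ.<⇒≤ (positive e h)))) ⟩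
        z * + ∣ l ∣                 ∎
        where
        a = x (gp# v (r e))
        b = x (gm# v (r e))
        a′ = x (gp# v (r (i e)))
        b′ = x (gm# v (r (i e)))
        l = x (l# e)
        z = q v e
        balance : (a + b′) + + negPart z * l ≡ (b + a′) + + posPart z * l
        balance = trans (cong (λ t → (a + b′) + t) (sym (⊗≡* (negPart z) l)))
          (trans (antisym (Realises.pl₁ (real v e h)) (Realises.pl₂ (real v e h)))
            (cong (λ t → (b + a′) + t) (⊗≡* (posPart z) l)))
        expand : ∀ a b a′ b′ s → (a - b) - (a′ - b′) ≡ ((a + b′) + s) - (b + a′) - s
        expand = ℤ-Ring.solve-∀
        contract : ∀ t p m l → (t + p * l) - t - m * l ≡ (p - m) * l
        contract = ℤ-Ring.solve-∀

    realisation⇒solution : Realisation → ∃ (Linear.Solves ℤ-model system)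
    -- Integer values can be negative already, so the subtracted half of each formal difference is
    -- taken to be 0.
    realisation⇒solution (L , g , isPL) = _ , system-solved ℤ-model (λ e → + len e) g (λ _ _ → + 0)
      (λ e h → +<+ (subst (0 ℕ.<_) (sym (ℕₚ.+-identityʳ (len e))) (len>0 e h)))
      (λ e h → cong +_ (len-sym e h)) balance
      where
      open Lengths L
      open ≡-Reasoning
      balance : ∀ v e → i e ≢ e → (g v (r e) + + 0) + Linear._⊗_ ℤ-model (negPart (q v e)) (+ len e)
                                ≡ (+ 0 + g v (r (i e))) + Linear._⊗_ ℤ-model (posPart (q v e)) (+ len e)
      balance v e h = begin
        (a + + 0) + Linear._⊗_ ℤ-model (negPart z) l  ≡⟨ cong (λ t → (a + + 0) + t) (⊗≡* (negPart z) l) ⟩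
        (a + + 0) + + negPart z * l                   ≡⟨ expand a b (+ negPart z * l) ⟩
        b + (a - b) + + negPart z * l                 ≡⟨ cong (λ t → b + t + + negPart z * l) (isPL v e h) ⟩
        b + z * l + + negPart z * l                   ≡⟨ cong (λ t → b + t * l + + negPart z * l) (posPart-negPart z) ⟨
        b + (+ posPart z - + negPart z) * l + + negPart z * l
                                                      ≡⟨ contract b (+ posPart z) (+ negPart z) l ⟩
        (+ 0 + b) + + posPart z * l                   ≡⟨ cong (λ t → (+ 0 + b) + t) (⊗≡* (posPart z) l) ⟨
        (+ 0 + b) + Linear._⊗_ ℤ-model (posPart z) l  ∎
        where
        a = g v (r e)
        b = g v (r (i e))
        l = + len e
        z = q v e
        expand : ∀ a b s → (a + + 0) + s ≡ b + (a - b) + s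
        expand = ℤ-Ring.solve-∀
        contract : ∀ b p m l → b + (p - m) * l + m * l ≡ (+ 0 + b) + p * l
        contract = ℤ-Ring.solve-∀

    realisation? : Dec Realisation
    realisation? = map′ solution⇒realisation realisation⇒solution (solvable? system)

  realisation-cong : ∀ {q q′} → (∀ v e → i e ≢ e → q v e ≡ q′ v e) → Realisation q → Realisation q′
  realisation-cong eq (L , g , isPL) = L , g , λ v e h → trans (isPL v e h) (cong (λ t → t * + Lengths.len L e) (eq v e h))

  module _ {c ℓ} (M : CommutativeMonoid c ℓ) (sharp : IsSharp M) (integral : IsIntegral M)
    (l : Fin n → CommutativeMonoid.Carrier M) (metric : IsMetrisation M G l) where
    open CommutativeMonoid M renaming (refl to ≈-refl; sym to ≈-sym; trans to ≈-trans)
    open IsMetrisation metric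

    -- The integers `q` are all that is carried over: they are the coefficients of the system, while
    -- its unknowns, the lengths and values, are solved for afresh over the integers.
    realise : (g : Fin n → Fin n → Gp M G) (q : Fin n → Fin n → ℤ) → (∀ v → PLWitness M G l (g v) (q v)) → Realisation q
    realise g q wit = solution⇒realisation q (transfer mod (system q) _
      (system-solved q mod l (λ v → proj₁ ∘ g v) (λ v → proj₂ ∘ g v)
        (λ e h → l e , (λ _ le≈ε → h (zero⇒vertex e le≈ε)) , identityˡ (l e)) (λ e h → l-sym e) balance))
      where
      mod = monoidModel M sharp integral
      open Linear mod using (_⊗_)
      times≈⊗ : ∀ m x → times M G m x ≈ m ⊗ x
      times≈⊗ zero    x = ≈-refl
      times≈⊗ (suc m) x = ∙-cong ≈-refl (times≈⊗ m x)
      fst≈ : ∀ z x → proj₁ (_·gp_ M G z x) ≈ posPart z ⊗ x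
      fst≈ (+ m)    x = times≈⊗ m x
      fst≈ -[1+ m ] x = ≈-refl
      snd≈ : ∀ z x → proj₂ (_·gp_ M G z x) ≈ negPart z ⊗ x
      snd≈ (+ m)    x = ≈-refl
      snd≈ -[1+ m ] x = times≈⊗ (suc m) x
      balance : ∀ v e → i e ≢ e →
        (proj₁ (g v (r e)) ∙ proj₂ (g v (r (i e)))) ∙ negPart (q v e) ⊗ l e
          ≈ (proj₂ (g v (r e)) ∙ proj₁ (g v (r (i e)))) ∙ posPart (q v e) ⊗ l e
      balance v e h = ≈-trans (∙-cong ≈-refl (≈-sym (snd≈ (q v e) (l e))))
        (≈-trans (wit v e h) (≈-trans (∙-cong (fst≈ (q v e) (l e)) ≈-refl) (comm _ _)))

-- Search for a covering divisor of least degree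

-- The form in which coverings are searched for. Divisor and slopes range over a finite set once `d`
-- is fixed; lengths and values are unbounded and therefore kept inside `realised`, which is
-- decidable for given slopes.
record Cover {n} (G : Graph n) (d : ℕ) : Set where
  open Graph G
  field
    D        : Fin n → ℤ
    q        : Fin n → Fin n → ℤ
    divisor  : ∀ x → i x ≢ x → D x ≡ + 0
    D≥0      : ∀ x → + 0 ≤ D x
    degree   : sumℤ D ≡ + d
    effect   : ∀ v x → + 0 ≤ D x + Lap G (q v) x
    hits     : ∀ v → i v ≡ v → + 1 ≤ D v + Lap G (q v) v
    realised : System.Realisation G q

Exhaustible : Set → Set₁
Exhaustible A = (P : A → Set) → (∀ a → Dec (P a)) → Dec (∃ P)

Vec-exhaustible : ∀ {A} n → Exhaustible A → Exhaustible (Vec A n)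
Vec-exhaustible zero    search P P? = map′ (λ p → [] , p) (λ { ([] , p) → p }) (P? [])
Vec-exhaustible (suc n) search P P? = map′ (λ (a , v , p) → a ∷ v , p) (λ { (a ∷ v , p) → a , v , p })
  (search (λ a → ∃ λ v → P (a ∷ v)) λ a → Vec-exhaustible n search (λ v → P (a ∷ v)) (λ v → P? (a ∷ v)))

module Bounded (d : ℕ) where

  Code : Set
  Code = Fin (suc (d ℕ.+ d))

  decode : Code → ℤ
  decode c = + toℕ c - + d

  encode : ℤ → Code
  -- Outside the interval from -d to d the code is arbitrary. This can occur only for the entries of
  -- `q` at vertices, and both the Laplacian and `Realisation` read `q` at half-edges only.
  encode z with ∣ z + + d ∣ ℕ.<? suc (d ℕ.+ d)
  ... | yes lt = fromℕ< lt
  ... | no _   = zero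

  decode-encode : ∀ z → - + d ≤ z → z ≤ + d → decode (encode z) ≡ z
  decode-encode z lo hi with ∣ z + + d ∣ ℕ.<? suc (d ℕ.+ d)
  ... | yes lt = trans (cong (λ t → + t - + d) (toℕ-fromℕ< lt)) (trans (cong (_- + d) shifted) (cancel z (+ d)))
    where
    cancel : ∀ a b → (a + b) - b ≡ a
    cancel = ℤ-Ring.solve-∀
    shifted : + ∣ z + + d ∣ ≡ z + + d
    shifted = ℤₚ.0≤i⇒+∣i∣≡i (subst (_≤ z + + d) (ℤₚ.+-inverseˡ (+ d)) (ℤₚ.+-monoˡ-≤ (+ d) lo))
  ... | no ¬lt = contradiction (ℕ.s≤s (ℤₚ.drop‿+≤+ (subst (_≤ + (d ℕ.+ d)) (sym shifted) (ℤₚ.+-monoˡ-≤ (+ d) hi)))) ¬lt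
    where
    shifted : + ∣ z + + d ∣ ≡ z + + d
    shifted = ℤₚ.0≤i⇒+∣i∣≡i (subst (_≤ z + + d) (ℤₚ.+-inverseˡ (+ d)) (ℤₚ.+-monoˡ-≤ (+ d) lo))

module _ {n} (G : Graph n) (d : ℕ) where
  open Graph G
  open System G
  open Bounded d

  IsCover : (Fin n → ℤ) → (Fin n → Fin n → ℤ) → Set
  IsCover D q = (∀ x → i x ≢ x → D x ≡ + 0) × (∀ x → + 0 ≤ D x) × sumℤ D ≡ + d
    × (∀ v x → + 0 ≤ D x + Lap G (q v) x) × (∀ v → i v ≡ v → + 1 ≤ D v + Lap G (q v) v) × Realisation q

  isCover? : ∀ D q → Dec (IsCover D q)
  isCover? D q = all? (λ x → ¬? (i x ≟ x) →-dec (D x ℤ.≟ + 0)) ×-dec all? (λ x → + 0 ℤ.≤? D x) ×-dec (sumℤ D ℤ.≟ + d)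
    ×-dec all? (λ v → all? λ x → + 0 ℤ.≤? D x + Lap G (q v) x)
    ×-dec all? (λ v → (i v ≟ v) →-dec (+ 1 ℤ.≤? D v + Lap G (q v) v)) ×-dec realisation? q

  toCover : ∀ {D q} → IsCover D q → Cover G d
  toCover (p₁ , p₂ , p₃ , p₄ , p₅ , p₆) = record
    { divisor = p₁ ; D≥0 = p₂ ; degree = p₃ ; effect = p₄ ; hits = p₅ ; realised = p₆ }

  decodeD : Vec (Vec Code n) (suc n) → Fin n → ℤ
  decodeD (D ∷ _) x = decode (lookup D x)

  decodeQ : Vec (Vec Code n) (suc n) → Fin n → Fin n → ℤ
  decodeQ (_ ∷ q) v e = decode (lookup (lookup q v) e)

  code : (Fin n → ℤ) → (Fin n → Fin n → ℤ) → Vec (Vec Code n) (suc n)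
  code D q = tabulate (encode ∘ D) ∷ tabulate (λ v → tabulate (encode ∘ q v))

  module _ (C : Cover G d) where
    open Cover C
    open Lengths (proj₁ realised)

    D-bounded : ∀ x → - + d ≤ D x × D x ≤ + d
    D-bounded x = ℤₚ.≤-trans (ℤₚ.neg-≤-pos {d} {0}) (D≥0 x) , subst (D x ≤_) degree (sumℤ-≥term x D D≥0)

    -- The lower bound is the flow bound `slope≤deg` for the reversed half-edge.
    q-bounded : ∀ v e → i e ≢ e → - + d ≤ q v e × q v e ≤ + d
    q-bounded v e h = subst (- + d ≤_) (trans (cong -_ anti) (ℤₚ.neg-involutive (q v e))) (ℤₚ.neg-mono-≤ (≤d (i e) (halfEdge-i G h)))
                    , ≤d e h
      where
      g = proj₁ (proj₂ realised) v
      isPL = proj₂ (proj₂ realised) v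
      anti = slope-antisym G (proj₁ realised) {g} {q v} isPL e h
      ≤d : ∀ e → i e ≢ e → q v e ≤ + d
      ≤d e h = subst (q v e ≤_) degree (slope≤deg G (proj₁ realised) {g} {q v} isPL D D≥0 (effect v) e h)

    D≡ : ∀ x → D x ≡ decodeD (code D q) x
    D≡ x = sym (trans (cong decode (lookup∘tabulate (encode ∘ D) x))
      (decode-encode (D x) (proj₁ (D-bounded x)) (proj₂ (D-bounded x))))

    q≡ : ∀ v e → i e ≢ e → q v e ≡ decodeQ (code D q) v e
    q≡ v e h = sym (trans (cong decode (trans (cong (λ t → lookup t e) (lookup∘tabulate (λ v → tabulate (encode ∘ q v)) v))
      (lookup∘tabulate (encode ∘ q v) e))) (decode-encode (q v e) (proj₁ (q-bounded v e h)) (proj₂ (q-bounded v e h))))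

    fromCover : IsCover (decodeD (code D q)) (decodeQ (code D q))
    fromCover = (λ x h → trans (sym (D≡ x)) (divisor x h)) , (λ x → subst (+ 0 ≤_) (D≡ x) (D≥0 x))
      , trans (sym (sumℤ-cong D≡)) degree
      , (λ v x → subst (+ 0 ≤_) (E≡ v x) (effect v x))
      , (λ v p → subst (+ 1 ≤_) (E≡ v v) (hits v p))
      , realisation-cong q≡ realised
      where
      E≡ : ∀ v x → D x + Lap G (q v) x ≡ decodeD (code D q) x + Lap G (decodeQ (code D q) v) x
      E≡ v x = cong₂ _+_ (D≡ x) (lap-cong G (q≡ v) x)

  cover? : Dec (Cover G d)
  cover? = map′ (λ (_ , p) → toCover p) (λ C → code (Cover.D C) (Cover.q C) , fromCover C)
    (Vec-exhaustible (suc n) (Vec-exhaustible n λ P P? → any? P?)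
      (λ c → IsCover (decodeD c) (decodeQ c)) (λ c → isCover? (decodeD c) (decodeQ c)))

least : (P : ℕ → Set) → (∀ d → Dec (P d)) → ∃ P → ∃[ d ] (P d × (∀ d′ → P d′ → d ℕ.≤ d′))
least P P? (N , p) = search N 0 (ℕₚ.+-identityʳ N) λ _ _ → ℕ.z≤n
  where
  search : ∀ fuel d → fuel ℕ.+ d ≡ N → (∀ d′ → P d′ → d ℕ.≤ d′) → ∃[ d ] (P d × (∀ d′ → P d′ → d ℕ.≤ d′))
  search fuel d eq low with P? d
  ... | yes q = d , q , low
  search zero       d eq low | no ¬q = contradiction (subst P (sym eq) p) ¬q
  search (suc fuel) d eq low | no ¬q = search fuel (suc d) (trans (ℕₚ.+-suc fuel d) eq)
    λ d′ p′ → ℕₚ.≤∧≢⇒< (low d′ p′) λ { refl → ¬q p′ }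

-- With a chip on every vertex no chip has to move. Its degree bounds the search for the least one.
vertexCover : ∀ {n} (G : Graph n) → ∃ (Cover G)
vertexCover {n} G = ∣ sumℤ D ∣ , record
  { D = D ; q = λ _ _ → + 0 ; divisor = div ; D≥0 = pos ; degree = sym (ℤₚ.0≤i⇒+∣i∣≡i (sumℤ-≥0 pos))
  ; effect = λ v x → subst (+ 0 ≤_) (E≡ x) (pos x)
  ; hits = λ v p → subst (+ 1 ≤_) (E≡ v) (ℤₚ.≤-reflexive (sym (one v p)))
  ; realised = record { len = λ _ → 1 ; len>0 = λ _ _ → ℕ.s≤s ℕ.z≤n ; len-sym = λ _ _ → refl }
             , (λ _ _ → + 0) , λ _ _ _ → refl }
  where
  open Graph G
  D : Fin n → ℤ
  D x = if does (i x ≟ x) then + 1 else + 0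
  div : ∀ x → i x ≢ x → D x ≡ + 0
  div x h with i x ≟ x
  ... | yes p = contradiction p h
  ... | no _  = refl
  one : ∀ x → i x ≡ x → D x ≡ + 1
  one x p with i x ≟ x
  ... | yes _ = refl
  ... | no h  = contradiction p h
  pos : ∀ x → + 0 ≤ D x
  pos x with i x ≟ x
  ... | yes _ = +≤+ ℕ.z≤n
  ... | no _  = +≤+ ℕ.z≤n
  E≡ : ∀ x → D x ≡ D x + Lap G (λ _ → + 0) x
  E≡ x = sym (trans (cong (λ t → D x + t) (lap-0 G x)) (ℤₚ.+-identityʳ (D x)))

-- An edge on which all slopes vanish may be given length 1, so it never has to be subdivided.
module Trim {n d} (G : Graph n) (C : Cover G d) (flat? : ∀ e → Dec (∀ v → Cover.q C v e ≡ + 0)) where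
  open Graph G
  open Cover C
  open Lengths (proj₁ realised)
  g = proj₁ (proj₂ realised)
  isPL = proj₂ (proj₂ realised)
  len′ : Fin n → ℕ
  len′ e = if does (flat? e) then 1 else len e
  pos : ∀ e → i e ≢ e → 0 ℕ.< len′ e
  pos e h with flat? e
  ... | yes _ = ℕ.s≤s ℕ.z≤n
  ... | no _  = len>0 e h
  flat-i : ∀ e → i e ≢ e → (∀ v → q v e ≡ + 0) → ∀ v → q v (i e) ≡ + 0
  flat-i e h flat v = trans (slope-antisym G (proj₁ realised) {g v} {q v} (isPL v) e h) (cong -_ (flat v))
  symm : ∀ e → i e ≢ e → len′ (i e) ≡ len′ e
  symm e h with flat? (i e) | flat? e
  ... | yes _ | yes _ = refl
  ... | no _  | no _  = len-sym e h
  ... | yes f | no ¬f = contradiction (λ v → subst (λ x → q v x ≡ + 0) (i-invol e) (flat-i (i e) (halfEdge-i G h) f v)) ¬f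
  ... | no ¬f | yes f = contradiction (flat-i e h f) ¬f
  pl′ : ∀ v → IsPL G len′ (g v) (q v)
  pl′ v e h with flat? e
  ... | yes f = trans (isPL v e h) (trans (cong (λ t → t * + len e) (f v)) (cong (λ t → t * + 1) (sym (f v))))
  ... | no _  = isPL v e h
  move : Fin n → Move G len′ D
  move v = record { value = g v ; slope = q v ; pl = pl′ v ; effective = effect v }
  slo : ∀ e → i e ≢ e → len′ e ≡ 1 ⊎ Σ (Move G len′ D) λ m → Move.slope m e ≢ + 0
  slo e h with flat? e
  ... | yes _ = inj₁ refl
  ... | no ¬f = inj₂ (move (proj₁ steep) , proj₂ steep)
    where steep = ¬∀⟶∃¬ n (λ v → q v e ≡ + 0) (λ v → q v e ℤ.≟ + 0) ¬f

  covering : Covering G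
  covering = record
    { lengths = record { len = len′ ; len>0 = pos ; len-sym = symm } ; D = D ; divisor = divisor ; D≥0 = D≥0
    ; covered = λ w p → inj₁ (move w , hits w p) ; sloped = slo }

-- From positive rank on Γ to a cover of G

module _ {c ℓ} (M : CommutativeMonoid c ℓ) (sharp : IsSharp M) (integral : IsIntegral M)
  {n} (G : Graph n) (l : Fin n → CommutativeMonoid.Carrier M) (metric : IsMetrisation M G l) where
  open Graph G

  module _ (D : Fin n → ℤ) (divisor : IsDivisor M G D) where

    HasMove : Fin n → Set (c ⊔ ℓ)
    HasMove v = ∃[ g ] ∃[ q ] (PLWitness M G l g q × (∀ x → + 0 ≤ D x + Lap G q x) × + 1 ≤ D v + Lap G q v)

    -- Positive rank is witnessed by some j ≥ 1, so the test divisor `F` puts j chips on `v`. If `E`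
    -- is effective and equivalent to D - F, then E + F = D + `Lap G q` is effective with at least j
    -- chips at `v`.
    rank⇒move : RankAtLeast M G l D 1 → ∀ v → i v ≡ v → HasMove v
    rank⇒move (j , 1≤j , rank) v vv = moved (rank F F-div F≥0 (sumℤ-point v (λ _ → + j)))
      where
      F : Fin n → ℤ
      F x = if does (v ≟ x) then + j else + 0
      F-div : ∀ x → i x ≢ x → F x ≡ + 0
      F-div x h with v ≟ x
      ... | yes refl = contradiction vv h
      ... | no _     = refl
      F≥0 : ∀ x → + 0 ≤ F x
      F≥0 x with v ≟ x
      ... | yes _ = +≤+ ℕ.z≤n
      ... | no _  = ℤₚ.≤-refl
      Fv : F v ≡ + j
      Fv with v ≟ v
      ... | yes _ = refl
      ... | no ¬p = contradiction refl ¬p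
      E+F : ∀ x {e p} → e - (D x - F x) ≡ p → e + F x ≡ D x + p
      E+F x {e} eq = trans (arrange e (D x) (F x)) (cong (λ t → D x + t) eq)
        where
        arrange : ∀ e d f → e + f ≡ d + (e - (d - f))
        arrange = ℤ-Ring.solve-∀
      moved : LinSysNonempty M G l (λ x → D x - F x) → HasMove v
      moved (E , _ , E≥0 , g , q , wit , eq) = g , q , wit
        , (λ x → subst (+ 0 ≤_) (E+F x {E x} (eq x)) (ℤₚ.+-mono-≤ (E≥0 x) (F≥0 x)))
        , subst (+ 1 ≤_) (E+F v {E v} (eq v)) (ℤₚ.+-mono-≤ (E≥0 v) (subst (+ 1 ≤_) (sym Fv) (+≤+ 1≤j)))

    -- The flow bound on slopes presupposes an effective divisor, and `D` may have negative
    -- coefficients. It is therefore replaced by the equivalent effective `D₀` reached by the move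
    -- for `v₀`, and all functions and slopes are taken relative to that move.
    rank⇒cover : RankAtLeast M G l D 1 → ∃[ d ] (sumℤ D ≡ + d × Cover G d)
    rank⇒cover rank = ∣ sumℤ D₀ ∣ , trans (sym deg≡) deg₀ , record
      { D = D₀ ; q = q₀ ; divisor = div ; D≥0 = D₀≥0 ; degree = deg₀
      ; effect = λ v x → subst (+ 0 ≤_) (E≡ v x) (proj₁ (proj₂ (proj₂ (proj₂ (move v)))) x)
      ; hits = λ v p → subst (+ 1 ≤_) (E≡ v v) (hit v p)
      ; realised = L , (λ v x → g v x - g v₀ x) , isPL₀ }
      where
      v₀ = proj₁ hasVertex
      -- Moves are indexed by all of `Fin n`; the vertex `v₀` serves as the default at half-edges.
      base-vertex : Fin n → Fin n
      base-vertex v = if does (i v ≟ v) then v else v₀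
      is-vertex : ∀ v → i (base-vertex v) ≡ base-vertex v
      is-vertex v with i v ≟ v
      ... | yes p = p
      ... | no _  = proj₂ hasVertex
      move : ∀ v → HasMove (base-vertex v)
      move v = rank⇒move rank (base-vertex v) (is-vertex v)
      q : Fin n → Fin n → ℤ
      q v = proj₁ (proj₂ (move v))
      hit : ∀ v → i v ≡ v → + 1 ≤ D v + Lap G (q v) v
      hit v p = subst (λ x → + 1 ≤ D x + Lap G (q v) x) (same p) (proj₂ (proj₂ (proj₂ (proj₂ (move v)))))
        where
        same : i v ≡ v → base-vertex v ≡ v
        same p with i v ≟ v
        ... | yes _ = refl
        ... | no h  = contradiction p h
      real : System.Realisation G q
      real = System.realise G M sharp integral l metric (λ v → proj₁ (move v)) q (λ v → proj₁ (proj₂ (proj₂ (move v))))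
      L = proj₁ real
      g = proj₁ (proj₂ real)
      isPL = proj₂ (proj₂ real)
      open Lengths L
      q₀ : Fin n → Fin n → ℤ
      q₀ v e = q v e - q v₀ e
      D₀ : Fin n → ℤ
      D₀ x = D x + Lap G (q v₀) x
      D₀≥0 : ∀ x → + 0 ≤ D₀ x
      D₀≥0 = proj₁ (proj₂ (proj₂ (proj₂ (move v₀))))
      div : ∀ x → i x ≢ x → D₀ x ≡ + 0
      div x h = cong₂ _+_ (divisor x h) (lap-nonvertex G (q v₀) x h)
      -- Antisymmetry of the slopes, which gives the Laplacian degree 0, is read off the integer
      -- realisation instead of being derived in `M`.
      deg≡ : sumℤ D₀ ≡ sumℤ D
      deg≡ = trans (sumℤ-+ D (Lap G (q v₀))) (trans (cong (λ t → sumℤ D + t)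
        (deg-lap G (q v₀) (slope-antisym G L {g v₀} {q v₀} (isPL v₀)))) (ℤₚ.+-identityʳ (sumℤ D)))
      deg₀ : sumℤ D₀ ≡ + ∣ sumℤ D₀ ∣
      deg₀ = sym (ℤₚ.0≤i⇒+∣i∣≡i (sumℤ-≥0 D₀≥0))
      E≡ : ∀ v x → D x + Lap G (q v) x ≡ D₀ x + Lap G (q₀ v) x
      E≡ v x = trans (arrange (D x) (Lap G (q v) x) (Lap G (q v₀) x)) (cong (λ t → D₀ x + t) (sym (lap-- G (q v) (q v₀) x)))
        where
        arrange : ∀ d a b → d + a ≡ (d + b) + (a - b)
        arrange = ℤ-Ring.solve-∀
      isPL₀ : ∀ v → IsPL G len (λ x → g v x - g v₀ x) (q₀ v)
      isPL₀ v e h = trans (arrange (g v (r e)) (g v₀ (r e)) (g v (r (i e))) (g v₀ (r (i e))))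
        (trans (cong₂ _-_ (isPL v e h) (isPL v₀ e h)) (factor (q v e) (q v₀ e) (+ len e)))
        where
        arrange : ∀ a b c d → (a - b) - (c - d) ≡ (a - c) - (b - d)
        arrange = ℤ-Ring.solve-∀
        factor : ∀ a b l → a * l - b * l ≡ (a - b) * l
        factor = ℤ-Ring.solve-∀

theorem4p11 : ∀ {c ℓ} (M : CommutativeMonoid c ℓ) → IsSharp M → IsIntegral M →
    ∀ {n} (G : Graph n) (l : Fin n → CommutativeMonoid.Carrier M) →
    IsMetrisation M G l →
    ∃[ m ] Σ (Graph m) (λ H → Subdivision G H ×
    (∀ dΓ dH → IsDgon M G l dΓ → IsDgonUnmetrised H dH → dH ≤ dΓ))
theorem4p11 M sharp integral G l metric = conclude (least (Cover G) (cover? G) (vertexCover G))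
  where
  Dominated : ∀ {m} → Graph m → Set _
  Dominated H = ∀ dΓ dH → IsDgon M G l dΓ → IsDgonUnmetrised H dH → dH ≤ dΓ

  dominated : ∀ {d m} {H : Graph m} → (∀ d′ → Cover G d′ → d ℕ.≤ d′) → UnitCovering H (+ d) → Dominated H
  dominated {d} {H = H} minimal (U , unit , deg≡) dΓ dH ((D , divisor , rank , refl) , _) (_ , dH-least) =
    compare (rank⇒cover M sharp integral G l metric D divisor rank)
    where
    compare : ∃[ d′ ] (sumℤ D ≡ + d′ × Cover G d′) → dH ≤ sumℤ D
    -- The chain is dH ≤ deg U = d ≤ d′ = deg D, where d was fixed before `D` was given.
    compare (d′ , eq , C′) = ℤₚ.≤-trans
      (dH-least (Covering.D U) (Covering.divisor U) (unitCovering-rank H U unit))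
      (subst₂ _≤_ (sym deg≡) (sym eq) (+≤+ (minimal d′ C′)))

  conclude : ∃[ d ] (Cover G d × (∀ d′ → Cover G d′ → d ℕ.≤ d′)) →
    ∃[ m ] Σ (Graph m) λ H → Subdivision G H × Dominated H
  conclude (d , C , minimal) = finish (subdivideFully base
      (Trim.covering G C λ e → all? λ v → Cover.q C v e ℤ.≟ + 0) (<-wellFounded _))
    where
    finish : (∃[ m ] Σ (Graph m) λ H → Subdivision G H × UnitCovering H (sumℤ (Cover.D C))) →
      ∃[ m ] Σ (Graph m) λ H → Subdivision G H × Dominated H
    finish (m , H , sub , U) = m , H , sub , dominated minimal (subst (UnitCovering H) (Cover.degree C) U)
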